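{- Let $R$ be a noetherian commutative ring and $S$ a multiplicative set of $R$ consisting of non-zero-divisors. Let $\Omega$ be the commutative monoid of finitely generated $R$-submodules of $S^{ -1}R$. Then the map $\mathcal{F}:\mathcal{M}\to\Omega$ defined by $\mathcal{F}(M)=\mathrm{Fitt}_R(M)$ is a Fitting invariant.
   Context: $\mathcal M$ is the category of finitely generated $S$-torsion $R$-modules and $\mathcal P=\{P\in\mathcal M\mid\mathrm{pd}_R(P)\le1\}$. $\mathrm{Fitt}_R(M)$ is the initial Fitting ideal: for a presentation $R^b\xrightarrow{h}R^a\to M\to0$, the ideal generated by the $a\times a$ minors of $h$. The monoid structure on $\Omega$ is the product of submodules. A Fitting invariant is a map $\mathcal F$ assigning to each object of $\mathcal M$ an element of a commutative monoid $\Omega$ such that: (i) $\mathcal F(P)\in\Omega^\times$ for $P\in\mathcal P$; (ii) if $0\to M'\to M\to P\to0$ is exact in $\mathcal M$ with $P\in\mathcal P$, then $\mathcal F(M)=\mathcal F(P)\mathcal F(M')$. -}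

module Defs where

open import Algebra.Bundles using (CommutativeRing; CommutativeMonoid)
open import Algebra.Definitions using (Invertible)
open import Algebra.Module.Bundles using (Module)
open import Algebra.Module.Construct.TensorUnit using (⟨module⟩)
open import Algebra.Module.Morphism.Structures using (module ModuleMorphisms)
open import Algebra.Module.Structures.Biased using (IsModuleFromLeft)
import Algebra.Properties.AbelianGroup as AbelianGroupProperties
import Algebra.Properties.CommutativeMonoid.Sum as SumProperties
import Algebra.Properties.Ring as RingProperties
import Algebra.Properties.Semiring.Exp as Exp
import Algebra.Solver.Ring.NaturalCoefficients.Default as RingSolver
open import Data.Fin.Base as Fin
  using (Fin; toℕ; punchIn; splitAt; combine; remQuot; finToFun; funToFin; _↑ˡ_; _↑ʳ_)
  renaming (zero to fzero; suc to fsuc)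
import Data.Fin.Properties as Finₚ
open import Data.Nat.Base using (ℕ; zero; suc; _^_) renaming (_+_ to _+ℕ_; _*_ to _*ℕ_)
open import Data.Product.Base using (Σ; ∃-syntax; _×_; _,_; proj₁; proj₂)
open import Data.Sum.Base using (inj₁; inj₂; [_,_]′)
open import Data.Vec.Functional using (_∷_)
open import Function.Bundles using (_⇔_; mk⇔)
open import Function.Definitions using (Injective; Surjective)
open import Level using (Level)
open import Relation.Binary.PropositionalEquality.Core as ≡ using (_≡_)
open import Relation.Binary.Structures using (IsEquivalence)
import Relation.Binary.Reasoning.Setoid as SetoidReasoning
open import Relation.Nullary.Decidable using (Dec; yes; no; _→-dec_)
open import Relation.Nullary.Negation using (contradiction)
open import Relation.Unary using (Pred; _≐_)

-- R-modules are taken with carrier and equality in the universe of R; this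
-- also bounds the modules quantified over in IsProjective.
module Modules {ℓ : Level} (R : CommutativeRing ℓ ℓ) where
  open CommutativeRing R hiding (zero)

  Mod : Set (Level.suc ℓ)
  Mod = Module R ℓ ℓ

  record Hom (A B : Mod) : Set ℓ where
    private
      module A = Module A
      module B = Module B
    open ModuleMorphisms A.rawModule B.rawModule
    field
      ⟦_⟧ : A.Carrierᴹ → B.Carrierᴹ
      isModuleHomomorphism : IsModuleHomomorphism ⟦_⟧
    open IsModuleHomomorphism isModuleHomomorphism public

  open Hom public using (⟦_⟧)

  module _ {A B : Mod} where
    private
      module A = Module A
      module B = Module B

    Inj : Hom A B → Set ℓ
    Inj f = Injective A._≈ᴹ_ B._≈ᴹ_ ⟦ f ⟧

    Surj : Hom A B → Set ℓ
    Surj f = Surjective A._≈ᴹ_ B._≈ᴹ_ ⟦ f ⟧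

    linear : (f : A.Carrierᴹ → B.Carrierᴹ) →
             (∀ {x y} → x A.≈ᴹ y → f x B.≈ᴹ f y) →
             (∀ x y → f (x A.+ᴹ y) B.≈ᴹ (f x B.+ᴹ f y)) →
             (∀ r x → f (r A.*ₗ x) B.≈ᴹ (r B.*ₗ f x)) →
             Hom A B
    linear f cong add scale = record
      { ⟦_⟧ = f
      ; isModuleHomomorphism = record
        { isBimoduleHomomorphism = record
          { +ᴹ-isGroupHomomorphism = record
            { isMonoidHomomorphism = record
              { isMagmaHomomorphism = record
                { isRelHomomorphism = record { cong = cong }
                ; homo = add
                }
              ; ε-homo = f0≈0
              }
            ; ⁻¹-homo = λ x → B.uniqueʳ‿-ᴹ (f x) (f (A.-ᴹ x))
                (B.≈ᴹ-trans (B.≈ᴹ-sym (add x (A.-ᴹ x)))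
                  (B.≈ᴹ-trans (cong (A.-ᴹ‿inverseʳ x)) f0≈0))
            }
          ; *ₗ-homo = scale
          ; *ᵣ-homo = λ r x →
              B.≈ᴹ-trans (cong (A.≈ᴹ-sym (A.*ₗ-*ᵣ-coincident r x)))
                (B.≈ᴹ-trans (scale r x) (B.*ₗ-*ᵣ-coincident r (f x)))
          }
        }
      }
      where
      f0≈0 : f A.0ᴹ B.≈ᴹ B.0ᴹ
      f0≈0 = B.≈ᴹ-trans (cong (A.≈ᴹ-sym (A.*ₗ-zeroˡ A.0ᴹ)))
               (B.≈ᴹ-trans (scale 0# A.0ᴹ) (B.*ₗ-zeroˡ (f A.0ᴹ)))

  ExactAt : {A B C : Mod} → Hom A B → Hom B C → Set ℓ
  ExactAt {A} {B} {C} f g =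
    ∀ b → (⟦ g ⟧ b C.≈ᴹ C.0ᴹ) ⇔ (∃[ a ] ⟦ f ⟧ a B.≈ᴹ b)
    where
    module B = Module B
    module C = Module C

  -- Exactness of 0 → A → B → C → 0.
  record IsShortExact {A B C : Mod} (f : Hom A B) (g : Hom B C) : Set ℓ where
    field
      injective  : Inj f
      exact      : ExactAt f g
      surjective : Surj g

  IsProjective : Mod → Set (Level.suc ℓ)
  IsProjective P =
    {A B : Mod} (g : Hom A B) → Surj g → (f : Hom P B) →
    ∃[ h ] (∀ x → Module._≈ᴹ_ B (⟦ g ⟧ (⟦_⟧ {P} {A} h x)) (⟦ f ⟧ x))

  -- A projective resolution 0 → P₁ → P₀ → P → 0 of length at most one; the
  -- terms are not required to be finitely generated.
  record ProjectiveDimension≤1 (P : Mod) : Set (Level.suc ℓ) where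
    field
      P₁ P₀         : Mod
      P₁-projective : IsProjective P₁
      P₀-projective : IsProjective P₀
      ∂             : Hom P₁ P₀
      ε             : Hom P₀ P
      isShortExact  : IsShortExact ∂ ε

  record Submodule (M : Mod) : Set (Level.suc ℓ) where
    open Module M
    field
      Mem       : Pred Carrierᴹ ℓ
      resp      : ∀ {x y} → x ≈ᴹ y → Mem x → Mem y
      0-closed  : Mem 0ᴹ
      +-closed  : ∀ {x y} → Mem x → Mem y → Mem (x +ᴹ y)
      *ₗ-closed : ∀ r {x} → Mem x → Mem (r *ₗ x)

  open Submodule public using (Mem)

  Ideal : Set (Level.suc ℓ)
  Ideal = Submodule ⟨module⟩

  module _ (M : Mod) where
    open Module M

    -- Least submodule containing X.
    data Span (X : Pred Carrierᴹ ℓ) : Pred Carrierᴹ ℓ where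
      gen   : ∀ {x} → X x → Span X x
      0∈    : Span X 0ᴹ
      +∈    : ∀ {x y} → Span X x → Span X y → Span X (x +ᴹ y)
      *ₗ∈   : ∀ r {x} → Span X x → Span X (r *ₗ x)
      resp∈ : ∀ {x y} → x ≈ᴹ y → Span X x → Span X y

    span : Pred Carrierᴹ ℓ → Submodule M
    span X = record
      { Mem = Span X ; resp = resp∈ ; 0-closed = 0∈ ; +-closed = +∈ ; *ₗ-closed = *ₗ∈ }

    range : ∀ {n} → (Fin n → Carrierᴹ) → Pred Carrierᴹ ℓ
    range g x = ∃[ i ] x ≈ᴹ g i

    IsFinitelyGenerated : Set ℓ
    IsFinitelyGenerated =
      ∃[ n ] Σ (Fin n → Carrierᴹ) λ g → ∀ x → Span (range g) x

    IsFinitelyGeneratedSubmodule : Submodule M → Set ℓ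
    IsFinitelyGeneratedSubmodule N =
      ∃[ n ] Σ (Fin n → Carrierᴹ) λ g → Mem N ≐ Span (range g)

    span-least : ∀ {X} (N : Submodule M) → (∀ {x} → X x → Mem N x) →
                 ∀ {x} → Span X x → Mem N x
    span-least N X⊆N (gen p)     = X⊆N p
    span-least N X⊆N 0∈          = Submodule.0-closed N
    span-least N X⊆N (+∈ p q)    = Submodule.+-closed N (span-least N X⊆N p) (span-least N X⊆N q)
    span-least N X⊆N (*ₗ∈ r p)   = Submodule.*ₗ-closed N r (span-least N X⊆N p)
    span-least N X⊆N (resp∈ e p) = Submodule.resp N e (span-least N X⊆N p)

    range-least : ∀ {n} {g : Fin n → Carrierᴹ} (N : Submodule M) → (∀ i → Mem N (g i)) →
                  ∀ {x} → Span (range g) x → Mem N x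
    range-least N g⊆N = span-least N λ (i , e) → Submodule.resp N (≈ᴹ-sym e) (g⊆N i)

    gen-range : ∀ {n} {g : Fin n → Carrierᴹ} i → Span (range g) (g i)
    gen-range i = gen (i , ≈ᴹ-refl)

    -‿closed : (N : Submodule M) → ∀ {x} → Mem N x → Mem N (-ᴹ x)
    -‿closed N {x} p = Submodule.resp N eq (Submodule.*ₗ-closed N (- 1#) p)
      where
      open SetoidReasoning ≈ᴹ-setoid
      eq : ((- 1#) *ₗ x) ≈ᴹ (-ᴹ x)
      eq = uniqueʳ‿-ᴹ x ((- 1#) *ₗ x) (begin
        x +ᴹ (- 1#) *ₗ x          ≈⟨ +ᴹ-congʳ (≈ᴹ-sym (*ₗ-identityˡ x)) ⟩
        1# *ₗ x +ᴹ (- 1#) *ₗ x    ≈⟨ ≈ᴹ-sym (*ₗ-distribʳ x 1# (- 1#)) ⟩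
        (1# + - 1#) *ₗ x          ≈⟨ *ₗ-congʳ (-‿inverseʳ 1#) ⟩
        0# *ₗ x                   ≈⟨ *ₗ-zeroˡ x ⟩
        0ᴹ                        ∎)

  module _ {A B : Mod} (f : Hom A B) where
    private
      module A = Module A
      module B = Module B
      module f = Hom f

    image : Submodule A → Submodule B
    image N = record
      { Mem       = λ y → ∃[ x ] Mem N x × ⟦ f ⟧ x B.≈ᴹ y
      ; resp      = λ e (x , p , q) → x , p , B.≈ᴹ-trans q e
      ; 0-closed  = A.0ᴹ , Submodule.0-closed N , f.0ᴹ-homo
      ; +-closed  = λ (x , p , q) (x′ , p′ , q′) →
          x A.+ᴹ x′ , Submodule.+-closed N p p′ , B.≈ᴹ-trans (f.+ᴹ-homo x x′) (B.+ᴹ-cong q q′)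
      ; *ₗ-closed = λ r (x , p , q) →
          r A.*ₗ x , Submodule.*ₗ-closed N r p , B.≈ᴹ-trans (f.*ₗ-homo r x) (B.*ₗ-congˡ q)
      }

    preimage : Submodule B → Submodule A
    preimage N = record
      { Mem       = λ x → Mem N (⟦ f ⟧ x)
      ; resp      = λ e → Submodule.resp N (f.⟦⟧-cong e)
      ; 0-closed  = Submodule.resp N (B.≈ᴹ-sym f.0ᴹ-homo) (Submodule.0-closed N)
      ; +-closed  = λ p q → Submodule.resp N (B.≈ᴹ-sym (f.+ᴹ-homo _ _)) (Submodule.+-closed N p q)
      ; *ₗ-closed = λ r p → Submodule.resp N (B.≈ᴹ-sym (f.*ₗ-homo r _)) (Submodule.*ₗ-closed N r p)
      }

    image-fg : ∀ {N} → IsFinitelyGeneratedSubmodule A N → IsFinitelyGeneratedSubmodule B (image N)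
    image-fg {N} (n , g , N⊆ , ⊆N) = n , fg , to , range-least B (image N) from
      where
      fg : Fin n → B.Carrierᴹ
      fg i = ⟦ f ⟧ (g i)
      to : ∀ {y} → Mem (image N) y → Span B (range B fg) y
      to (x , p , q) = resp∈ q
        (range-least A (preimage (span B (range B fg))) (gen-range B) (N⊆ p))
      from : ∀ i → Mem (image N) (fg i)
      from i = g i , ⊆N (gen-range A i) , B.≈ᴹ-refl

    kernel : Submodule A
    kernel = preimage record
      { Mem       = B._≈ᴹ B.0ᴹ
      ; resp      = λ e p → B.≈ᴹ-trans (B.≈ᴹ-sym e) p
      ; 0-closed  = B.≈ᴹ-refl
      ; +-closed  = λ p q → B.≈ᴹ-trans (B.+ᴹ-cong p q) (B.+ᴹ-identityˡ B.0ᴹ)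
      ; *ₗ-closed = λ r p → B.≈ᴹ-trans (B.*ₗ-congˡ p) (B.*ₗ-zeroʳ r)
      }

  IsNoetherian : Set (Level.suc ℓ)
  IsNoetherian = (I : Ideal) → IsFinitelyGeneratedSubmodule ⟨module⟩ I

  Free : ℕ → Mod
  Free n = record
    { Carrierᴹ = Fin n → Carrier
    ; _≈ᴹ_     = λ v w → ∀ i → v i ≈ w i
    ; _+ᴹ_     = λ v w i → v i + w i
    ; _*ₗ_     = λ r v i → r * v i
    ; _*ᵣ_     = λ v r i → r * v i
    ; 0ᴹ       = λ _ → 0#
    ; -ᴹ_      = λ v i → - v i
    ; isModule = IsModuleFromLeft.isModule record { isLeftModule = record
      { isLeftSemimodule = record
        { +ᴹ-isCommutativeMonoid = record
          { isMonoid = record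
            { isSemigroup = record
              { isMagma = record
                { isEquivalence = record
                  { refl  = λ _ → refl
                  ; sym   = λ p i → sym (p i)
                  ; trans = λ p q i → trans (p i) (q i)
                  }
                ; ∙-cong = λ p q i → +-cong (p i) (q i)
                }
              ; assoc = λ u v w i → +-assoc (u i) (v i) (w i)
              }
            ; identity = (λ v i → +-identityˡ (v i)) , (λ v i → +-identityʳ (v i))
            }
          ; comm = λ v w i → +-comm (v i) (w i)
          }
        ; isPreleftSemimodule = record
          { *ₗ-cong      = λ p q i → *-cong p (q i)
          ; *ₗ-zeroˡ     = λ v i → zeroˡ (v i)
          ; *ₗ-distribʳ  = λ v r s i → distribʳ (v i) r s
          ; *ₗ-identityˡ = λ v i → *-identityˡ (v i)
          ; *ₗ-assoc     = λ r s v i → *-assoc r s (v i)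
          ; *ₗ-zeroʳ     = λ r i → zeroʳ r
          ; *ₗ-distribˡ  = λ r v w i → distribˡ r (v i) (w i)
          }
        }
      ; -ᴹ‿cong    = λ p i → -‿cong (p i)
      ; -ᴹ‿inverse = (λ v i → -‿inverseˡ (v i)) , (λ v i → -‿inverseʳ (v i))
      } }
    }

  basis : ∀ {n} → Fin n → Fin n → Carrier
  basis fzero    fzero    = 1#
  basis fzero    (fsuc _) = 0#
  basis (fsuc _) fzero    = 0#
  basis (fsuc i) (fsuc j) = basis i j

  matrix : ∀ {a b} → Hom (Free b) (Free a) → Fin a → Fin b → Carrier
  matrix h i j = ⟦ h ⟧ (basis j) i

  -- An exact sequence R^b → R^a → M → 0.
  record Presentation (M : Mod) : Set ℓ where
    field
      a b        : ℕ
      h          : Hom (Free b) (Free a)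
      π          : Hom (Free a) M
      exact      : ExactAt h π
      surjective : Surj π

  open SumProperties +-commutativeMonoid using (sum; sum-cong-≋) public
  open Exp semiring using () renaming (_^_ to _^ᴿ_)

  -- Laplace expansion along the first row.
  det : ∀ {n} → (Fin n → Fin n → Carrier) → Carrier
  det {zero}  A = 1#
  det {suc n} A = sum λ j →
    ((- 1#) ^ᴿ toℕ j) * (A fzero j * det (λ i k → A (fsuc i) (punchIn j k)))

  det-cong : ∀ {n} {A B : Fin n → Fin n → Carrier} → (∀ i j → A i j ≈ B i j) → det A ≈ det B
  det-cong {zero}  A≈B = refl
  det-cong {suc n} A≈B = sum-cong-≋ λ j →
    *-congˡ {(- 1#) ^ᴿ toℕ j} (*-cong (A≈B fzero j) (det-cong λ i k → A≈B (fsuc i) (punchIn j k)))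

  StrictlyIncreasing : ∀ {a b} → (Fin a → Fin b) → Set
  StrictlyIncreasing σ = ∀ i j → i Fin.< j → σ i Fin.< σ j

  strictlyIncreasing? : ∀ {a b} (σ : Fin a → Fin b) → Dec (StrictlyIncreasing σ)
  strictlyIncreasing? σ = Finₚ.all? λ i → Finₚ.all? λ j → (i Finₚ.<? j) →-dec (σ i Finₚ.<? σ j)

  module _ {M : Mod} (P : Presentation M) where
    open Presentation P

    minor : (Fin a → Fin b) → Carrier
    minor σ = det λ i j → matrix h i (σ j)

    -- The a × a minors: one for each choice of a columns, in increasing order.
    IsMaximalMinor : Pred Carrier ℓ
    IsMaximalMinor x = ∃[ σ ] StrictlyIncreasing σ × x ≈ minor σ

    fittingIdeal : Ideal
    fittingIdeal = span ⟨module⟩ IsMaximalMinor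

    fittingIdeal-fg : IsFinitelyGeneratedSubmodule ⟨module⟩ fittingIdeal
    fittingIdeal-fg = b ^ a , g , span-least ⟨module⟩ (span ⟨module⟩ (range ⟨module⟩ g)) to
                                , range-least ⟨module⟩ fittingIdeal from
      where
      entry : (σ : Fin a → Fin b) → Dec (StrictlyIncreasing σ) → Carrier
      entry σ (yes _) = minor σ
      entry σ (no _)  = 0#

      g : Fin (b ^ a) → Carrier
      g k = entry (finToFun k) (strictlyIncreasing? (finToFun k))

      from : ∀ k → Mem fittingIdeal (g k)
      from k with strictlyIncreasing? (finToFun {b} {a} k)
      ... | yes inc = gen (finToFun k , inc , refl)
      ... | no _    = 0∈

      minor-cong : ∀ {σ τ} → (∀ i → σ i ≡ τ i) → minor σ ≈ minor τ
      minor-cong e = det-cong λ i j → reflexive (≡.cong (matrix h i) (e j))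

      entry≈ : ∀ {σ} → StrictlyIncreasing σ → ∀ τ → (∀ i → τ i ≡ σ i) → ∀ d → entry τ d ≈ minor σ
      entry≈ inc τ e (yes _) = minor-cong e
      entry≈ inc τ e (no ¬p) =
        contradiction (λ i j i<j → ≡.subst₂ Fin._<_ (≡.sym (e i)) (≡.sym (e j)) (inc i j i<j)) ¬p

      to : ∀ {x} → IsMaximalMinor x → Span ⟨module⟩ (range ⟨module⟩ g) x
      to (σ , inc , x≈) = gen (funToFin σ , trans x≈ (sym
        (entry≈ inc _ (Finₚ.finToFun-funToFin σ) (strictlyIncreasing? (finToFun (funToFin σ))))))

  module _ (M : Mod) where
    open Module M

    combination : ∀ {n} → (Fin n → Carrierᴹ) → (Fin n → Carrier) → Carrierᴹ
    combination {zero}  g v = 0ᴹ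
    combination {suc n} g v =
      v fzero *ₗ g fzero +ᴹ combination (λ i → g (fsuc i)) (λ i → v (fsuc i))

    open SetoidReasoning ≈ᴹ-setoid

    comb-cong : ∀ {n} (g : Fin n → Carrierᴹ) {v w} → (∀ i → v i ≈ w i) →
                combination g v ≈ᴹ combination g w
    comb-cong {zero}  g e = ≈ᴹ-refl
    comb-cong {suc n} g e =
      +ᴹ-cong (*ₗ-congʳ (e fzero)) (comb-cong (λ i → g (fsuc i)) (λ i → e (fsuc i)))

    interchange : ∀ x y z w → ((x +ᴹ y) +ᴹ (z +ᴹ w)) ≈ᴹ ((x +ᴹ z) +ᴹ (y +ᴹ w))
    interchange x y z w = begin
      (x +ᴹ y) +ᴹ (z +ᴹ w) ≈⟨ +ᴹ-assoc x y (z +ᴹ w) ⟩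
      x +ᴹ (y +ᴹ (z +ᴹ w)) ≈⟨ +ᴹ-congˡ (≈ᴹ-sym (+ᴹ-assoc y z w)) ⟩
      x +ᴹ ((y +ᴹ z) +ᴹ w) ≈⟨ +ᴹ-congˡ (+ᴹ-congʳ (+ᴹ-comm y z)) ⟩
      x +ᴹ ((z +ᴹ y) +ᴹ w) ≈⟨ +ᴹ-congˡ (+ᴹ-assoc z y w) ⟩
      x +ᴹ (z +ᴹ (y +ᴹ w)) ≈⟨ ≈ᴹ-sym (+ᴹ-assoc x z (y +ᴹ w)) ⟩
      (x +ᴹ z) +ᴹ (y +ᴹ w) ∎

    comb-+ : ∀ {n} (g : Fin n → Carrierᴹ) v w →
             combination g (λ i → v i + w i) ≈ᴹ (combination g v +ᴹ combination g w)
    comb-+ {zero}  g v w = ≈ᴹ-sym (+ᴹ-identityˡ 0ᴹ)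
    comb-+ {suc n} g v w = ≈ᴹ-trans
      (+ᴹ-cong (*ₗ-distribʳ (g fzero) (v fzero) (w fzero)) (comb-+ (λ i → g (fsuc i)) _ _))
      (interchange _ _ _ _)

    comb-* : ∀ {n} (g : Fin n → Carrierᴹ) r v →
             combination g (λ i → r * v i) ≈ᴹ (r *ₗ combination g v)
    comb-* {zero}  g r v = ≈ᴹ-sym (*ₗ-zeroʳ r)
    comb-* {suc n} g r v = ≈ᴹ-trans
      (+ᴹ-cong (*ₗ-assoc r (v fzero) (g fzero)) (comb-* (λ i → g (fsuc i)) r _))
      (≈ᴹ-sym (*ₗ-distribˡ r _ _))

    comb-0 : ∀ {n} (g : Fin n → Carrierᴹ) → combination g (λ _ → 0#) ≈ᴹ 0ᴹ
    comb-0 {zero}  g = ≈ᴹ-refl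
    comb-0 {suc n} g = ≈ᴹ-trans
      (+ᴹ-cong (*ₗ-zeroˡ (g fzero)) (comb-0 (λ i → g (fsuc i)))) (+ᴹ-identityˡ 0ᴹ)

    combination-basis : ∀ {n} (g : Fin n → Carrierᴹ) i → combination g (basis i) ≈ᴹ g i
    combination-basis g fzero    = ≈ᴹ-trans
      (+ᴹ-cong (*ₗ-identityˡ (g fzero)) (comb-0 (λ i → g (fsuc i)))) (+ᴹ-identityʳ (g fzero))
    combination-basis g (fsuc i) = ≈ᴹ-trans
      (+ᴹ-cong (*ₗ-zeroˡ (g fzero)) (combination-basis (λ i → g (fsuc i)) i)) (+ᴹ-identityˡ _)

    combination-closed : (N : Submodule M) → ∀ {n} {g : Fin n → Carrierᴹ} →
                         (∀ i → Mem N (g i)) → ∀ v → Mem N (combination g v)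
    combination-closed N {zero}  g∈ v = Submodule.0-closed N
    combination-closed N {suc n} g∈ v = Submodule.+-closed N
      (Submodule.*ₗ-closed N (v fzero) (g∈ fzero))
      (combination-closed N (λ i → g∈ (fsuc i)) (λ i → v (fsuc i)))

    fromFree : ∀ {n} → (Fin n → Carrierᴹ) → Hom (Free n) M
    fromFree g = linear {Free _} {M} (combination g) (comb-cong g) (comb-+ g) (comb-* g)

    span⇒combination : ∀ {n} {g : Fin n → Carrierᴹ} {x} →
                       Span M (range M g) x → ∃[ v ] combination g v ≈ᴹ x
    span⇒combination {n} {g} p
      with range-least M (image (fromFree g) (span (Free n) (range (Free n) basis)))
             (λ i → basis i , gen-range (Free n) i , combination-basis g i) p
    ... | v , _ , e = v , e

  module _ (noetherian : IsNoetherian) where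

    free-fg : ∀ n (N : Submodule (Free n)) → IsFinitelyGeneratedSubmodule (Free n) N
    free-fg zero    N = 0 , (λ ()) , (λ _ → resp∈ (λ ()) 0∈) , range-least (Free 0) N (λ ())
    free-fg (suc n) N = k +ℕ l , G , N⊆G , range-least F N G⊆N
      where
      F = Free (suc n)
      module F = Module F

      lead : Submodule F → Ideal
      lead N = image (linear {F} {⟨module⟩} (λ v → v fzero) (λ e → e fzero)
                        (λ _ _ → refl) (λ _ _ → refl)) N

      rest : Submodule F → Submodule (Free n)
      rest N = preimage (linear {Free n} {F} (λ w → 0# ∷ w)
        (λ e → λ { fzero → refl ; (fsuc i) → e i })
        (λ v w → λ { fzero → sym (+-identityˡ 0#) ; (fsuc i) → refl })
        (λ r w → λ { fzero → sym (zeroʳ r) ; (fsuc i) → refl })) N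

      lead-fg = noetherian (lead N)
      rest-fg = free-fg n (rest N)
      k = proj₁ lead-fg
      l = proj₁ rest-fg
      r = proj₁ (proj₂ lead-fg)
      w = proj₁ (proj₂ rest-fg)

      r∈ : ∀ i → Mem (lead N) (r i)
      r∈ i = proj₂ (proj₂ (proj₂ lead-fg)) (gen-range ⟨module⟩ i)

      v : Fin k → F.Carrierᴹ
      v i = proj₁ (r∈ i)

      G : Fin (k +ℕ l) → F.Carrierᴹ
      G i = [ v , (λ j → 0# ∷ w j) ]′ (splitAt k i)

      G⊆N : ∀ i → Mem N (G i)
      G⊆N i with splitAt k i
      ... | inj₁ j = proj₁ (proj₂ (r∈ j))
      ... | inj₂ j = proj₂ (proj₂ (proj₂ rest-fg)) (gen-range (Free n) j)

      ⟨G⟩ : Submodule F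
      ⟨G⟩ = span F (range F G)

      v∈G : ∀ i → Mem ⟨G⟩ (v i)
      v∈G i = gen (i ↑ˡ l , λ m → reflexive
        (≡.cong (λ s → [ v , (λ j → 0# ∷ w j) ]′ s m) (≡.sym (Finₚ.splitAt-↑ˡ k i l))))

      w∈G : ∀ j → Mem ⟨G⟩ (0# ∷ w j)
      w∈G j = gen (k ↑ʳ j , λ m → reflexive
        (≡.cong (λ s → [ v , (λ j → 0# ∷ w j) ]′ s m) (≡.sym (Finₚ.splitAt-↑ʳ k l j))))

      N⊆G : ∀ {x} → Mem N x → Mem ⟨G⟩ x
      N⊆G {x} x∈N
        with range-least ⟨module⟩ (lead ⟨G⟩) (λ i → v i , v∈G i , proj₂ (proj₂ (r∈ i)))
               (proj₁ (proj₂ (proj₂ lead-fg)) (x , x∈N , refl))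
      ... | y , y∈G , y₀≈x₀ =
        resp∈ x≈ (+∈ y∈G (range-least (Free n) (rest ⟨G⟩) w∈G
          (proj₁ (proj₂ (proj₂ rest-fg)) (Submodule.resp N z≈ z∈N))))
        where
        z : F.Carrierᴹ
        z = x F.+ᴹ (F.-ᴹ y)
        z∈N : Mem N z
        z∈N = Submodule.+-closed N x∈N (-‿closed F N (range-least F N G⊆N y∈G))
        z≈ : z F.≈ᴹ (0# ∷ λ i → z (fsuc i))
        z≈ fzero    = trans (+-congˡ (-‿cong y₀≈x₀)) (-‿inverseʳ (x fzero))
        z≈ (fsuc i) = refl
        x≈ : (y F.+ᴹ (0# ∷ λ i → z (fsuc i))) F.≈ᴹ x
        x≈ = F.≈ᴹ-trans (F.+ᴹ-congˡ {y} (F.≈ᴹ-sym z≈))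
          λ i → xyx⁻¹≈y (y i) (x i)
          where
          xyx⁻¹≈y : ∀ p q → p + (q + - p) ≈ q
          xyx⁻¹≈y p q = trans (sym (+-assoc p q (- p)))
            (AbelianGroupProperties.xyx⁻¹≈y +-abelianGroup p q)

    finitePresentation : ∀ {M} → IsFinitelyGenerated M → Presentation M
    finitePresentation {M} (n , g , g-gen) with free-fg n (kernel (fromFree M g))
    ... | m , c , to , from = record
      { a          = n
      ; b          = m
      ; h          = fromFree (Free n) c
      ; π          = fromFree M g
      ; exact      = λ v → mk⇔ (λ p → span⇒combination (Free n) (to p))
          λ (u , e) → Submodule.resp K e (combination-closed (Free n) K
                        (λ i → from (gen-range (Free n) i)) u)
      ; surjective = λ x → let (v , e) = span⇒combination M (g-gen x) in
          v , λ z≈v → Module.≈ᴹ-trans M (Hom.⟦⟧-cong (fromFree M g) z≈v) e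
      }
      where K = kernel (fromFree M g)

module Localization {ℓ : Level} (R : CommutativeRing ℓ ℓ) where
  open CommutativeRing R hiding (zero)
  open Modules R
  open RingSolver commutativeSemiring

  record IsMultiplicative (S : Pred Carrier ℓ) : Set ℓ where
    field
      S-resp : ∀ {x y} → x ≈ y → S x → S y
      1∈S    : S 1#
      *∈S    : ∀ {x y} → S x → S y → S (x * y)

  IsNonZeroDivisor : Carrier → Set ℓ
  IsNonZeroDivisor s = ∀ x → s * x ≈ 0# → x ≈ 0#

  module _ (S : Pred Carrier ℓ) (mult : IsMultiplicative S) where
    open IsMultiplicative mult

    record Fraction : Set ℓ where
      constructor frac
      field
        num   : Carrier
        den   : Carrier
        den∈S : S den
    open Fraction

    -- n/d = n′/d′ iff t(nd′ − n′d) = 0 for some t ∈ S.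
    infix 4 _≃_
    record _≃_ (x y : Fraction) : Set ℓ where
      constructor witness
      field
        t   : Carrier
        t∈S : S t
        eq  : t * (num x * den y) ≈ t * (num y * den x)

    cross : ∀ {x y} → num x * den y ≈ num y * den x → x ≃ y
    cross e = witness 1# 1∈S (*-congˡ e)

    open SetoidReasoning setoid

    ≃-isEquivalence : IsEquivalence _≃_
    ≃-isEquivalence = record
      { refl  = cross refl
      ; sym   = λ (witness t t∈ e) → witness t t∈ (sym e)
      ; trans = λ {x} {y} {z} (witness t t∈ e) (witness u u∈ f) →
          witness (t * u * den y) (*∈S (*∈S t∈ u∈) (den∈S y)) (begin
            t * u * den y * (num x * den z)   ≈⟨ solve 5 (λ t u d n d′ → t :* u :* d :* (n :* d′) := (t :* (n :* d)) :* (u :* d′)) refl t u (den y) (num x) (den z) ⟩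
            t * (num x * den y) * (u * den z) ≈⟨ *-congʳ e ⟩
            t * (num y * den x) * (u * den z) ≈⟨ solve 5 (λ t n d u d′ → t :* (n :* d) :* (u :* d′) := (t :* d) :* (u :* (n :* d′))) refl t (num y) (den x) u (den z) ⟩
            t * den x * (u * (num y * den z)) ≈⟨ *-congˡ f ⟩
            t * den x * (u * (num z * den y)) ≈⟨ solve 5 (λ t d u n d′ → t :* d :* (u :* (n :* d′)) := t :* u :* d′ :* (n :* d)) refl t (den x) u (num z) (den y) ⟩
            t * u * den y * (num z * den x)   ∎)
      }

    fractionRing : CommutativeRing ℓ ℓ
    fractionRing = record
      { Carrier = Fraction
      ; _≈_     = _≃_
      ; _+_     = add
      ; _*_     = mul
      ; -_      = neg
      ; 0#      = frac 0# 1# 1∈S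
      ; 1#      = frac 1# 1# 1∈S
      ; isCommutativeRing = record
        { isRing = record
          { +-isAbelianGroup = record
            { isGroup = record
              { isMonoid = record
                { isSemigroup = record
                  { isMagma = record
                    { isEquivalence = ≃-isEquivalence
                    ; ∙-cong = λ {x} {x′} {y} {y′} → add-cong {x} {x′} {y} {y′}
                    }
                  ; assoc = λ (frac n d _) (frac n′ d′ _) (frac n″ d″ _) → cross
                      (solve 6 (λ n d n′ d′ n″ d″ →
                        ((n :* d′ :+ n′ :* d) :* d″ :+ n″ :* (d :* d′)) :* (d :* (d′ :* d″)) :=
                        (n :* (d′ :* d″) :+ (n′ :* d″ :+ n″ :* d′) :* d) :* (d :* d′ :* d″))
                        refl n d n′ d′ n″ d″)
                  }
                ; identity = (λ (frac n d _) → cross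
                                (solve 2 (λ n d → (con 0 :* d :+ n :* con 1) :* d := n :* (con 1 :* d))
                                  refl n d))
                           , (λ (frac n d _) → cross
                                (solve 2 (λ n d → (n :* con 1 :+ con 0 :* d) :* d := n :* (d :* con 1))
                                  refl n d))
                }
              ; inverse = (λ (frac n d _) → cross (neg-inverse n d (-‿inverseˡ n)))
                        , (λ (frac n d _) → cross (neg-inverse′ n d (-‿inverseʳ n)))
              ; ⁻¹-cong = λ {x} {y} (witness t t∈ e) → witness t t∈ (begin
                  t * (- num x * den y)   ≈⟨ neg-out t (num x) (den y) ⟩
                  - (t * (num x * den y)) ≈⟨ -‿cong e ⟩
                  - (t * (num y * den x)) ≈⟨ sym (neg-out t (num y) (den x)) ⟩
                  t * (- num y * den x)   ∎)
              }
            ; comm = λ (frac n d _) (frac n′ d′ _) → cross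
                (solve 4 (λ n d n′ d′ → (n :* d′ :+ n′ :* d) :* (d′ :* d) :=
                                        (n′ :* d :+ n :* d′) :* (d :* d′)) refl n d n′ d′)
            }
          ; *-cong = λ {x} {x′} {y} {y′} → mul-cong {x} {x′} {y} {y′}
          ; *-assoc = λ (frac n d _) (frac n′ d′ _) (frac n″ d″ _) → cross
              (solve 6 (λ n d n′ d′ n″ d″ →
                n :* n′ :* n″ :* (d :* (d′ :* d″)) := n :* (n′ :* n″) :* (d :* d′ :* d″))
                refl n d n′ d′ n″ d″)
          ; *-identity = (λ (frac n d _) → cross
                            (solve 2 (λ n d → con 1 :* n :* d := n :* (con 1 :* d)) refl n d))
                       , (λ (frac n d _) → cross
                            (solve 2 (λ n d → n :* con 1 :* d := n :* (d :* con 1)) refl n d))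
          ; distrib = (λ (frac n d _) (frac n′ d′ _) (frac n″ d″ _) → cross
                         (solve 6 (λ n d n′ d′ n″ d″ →
                           n :* (n′ :* d″ :+ n″ :* d′) :* (d :* d′ :* (d :* d″)) :=
                           (n :* n′ :* (d :* d″) :+ n :* n″ :* (d :* d′)) :* (d :* (d′ :* d″)))
                           refl n d n′ d′ n″ d″))
                    , (λ (frac n d _) (frac n′ d′ _) (frac n″ d″ _) → cross
                         (solve 6 (λ n d n′ d′ n″ d″ →
                           (n′ :* d″ :+ n″ :* d′) :* n :* (d′ :* d :* (d″ :* d)) :=
                           (n′ :* n :* (d″ :* d) :+ n″ :* n :* (d′ :* d)) :* (d′ :* d″ :* d))
                           refl n d n′ d′ n″ d″))
          }
        ; *-comm = λ (frac n d _) (frac n′ d′ _) → cross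
            (solve 4 (λ n d n′ d′ → n :* n′ :* (d′ :* d) := n′ :* n :* (d :* d′)) refl n d n′ d′)
        }
      }
      where
      add mul : Fraction → Fraction → Fraction
      add x y = frac (num x * den y + num y * den x) (den x * den y) (*∈S (den∈S x) (den∈S y))
      mul x y = frac (num x * num y) (den x * den y) (*∈S (den∈S x) (den∈S y))

      neg : Fraction → Fraction
      neg x = frac (- num x) (den x) (den∈S x)

      add-cong : ∀ {x x′ y y′} → x ≃ x′ → y ≃ y′ → add x y ≃ add x′ y′
      add-cong {frac n d _} {frac n′ d′ _} {frac m e _} {frac m′ e′ _} (witness t t∈ p) (witness u u∈ q) =
        witness (t * u) (*∈S t∈ u∈) (begin
          t * u * ((n * e + m * d) * (d′ * e′))
            ≈⟨ solve 8 (λ t u n d m e d′ e′ →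
                 t :* u :* ((n :* e :+ m :* d) :* (d′ :* e′)) :=
                 t :* (n :* d′) :* (u :* e :* e′) :+ u :* (m :* e′) :* (t :* d :* d′))
                 refl t u n d m e d′ e′ ⟩
          t * (n * d′) * (u * e * e′) + u * (m * e′) * (t * d * d′)
            ≈⟨ +-cong (*-congʳ p) (*-congʳ q) ⟩
          t * (n′ * d) * (u * e * e′) + u * (m′ * e) * (t * d * d′)
            ≈⟨ solve 8 (λ t u n′ d m′ e d′ e′ →
                 t :* (n′ :* d) :* (u :* e :* e′) :+ u :* (m′ :* e) :* (t :* d :* d′) :=
                 t :* u :* ((n′ :* e′ :+ m′ :* d′) :* (d :* e)))
                 refl t u n′ d m′ e d′ e′ ⟩
          t * u * ((n′ * e′ + m′ * d′) * (d * e)) ∎)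

      mul-cong : ∀ {x x′ y y′} → x ≃ x′ → y ≃ y′ → mul x y ≃ mul x′ y′
      mul-cong {frac n d _} {frac n′ d′ _} {frac m e _} {frac m′ e′ _} (witness t t∈ p) (witness u u∈ q) =
        witness (t * u) (*∈S t∈ u∈) (begin
          t * u * (n * m * (d′ * e′))
            ≈⟨ solve 6 (λ t u n m d′ e′ →
                 t :* u :* (n :* m :* (d′ :* e′)) := t :* (n :* d′) :* (u :* (m :* e′)))
                 refl t u n m d′ e′ ⟩
          t * (n * d′) * (u * (m * e′))
            ≈⟨ *-cong p q ⟩
          t * (n′ * d) * (u * (m′ * e))
            ≈⟨ solve 6 (λ t u n′ m′ d e →
                 t :* (n′ :* d) :* (u :* (m′ :* e)) := t :* u :* (n′ :* m′ :* (d :* e)))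
                 refl t u n′ m′ d e ⟩
          t * u * (n′ * m′ * (d * e)) ∎)

      neg-out : ∀ t n d → t * (- n * d) ≈ - (t * (n * d))
      neg-out t n d = trans (*-congˡ (sym (RingProperties.-‿distribˡ-* ring n d)))
                            (sym (RingProperties.-‿distribʳ-* ring t (n * d)))

      neg-inverse : ∀ n d → - n + n ≈ 0# → (- n * d + n * d) * 1# ≈ 0# * (d * d)
      neg-inverse n d e = begin
        (- n * d + n * d) * 1# ≈⟨ *-identityʳ _ ⟩
        - n * d + n * d        ≈⟨ sym (distribʳ d (- n) n) ⟩
        (- n + n) * d          ≈⟨ *-congʳ e ⟩
        0# * d                 ≈⟨ trans (zeroˡ d) (sym (zeroˡ (d * d))) ⟩
        0# * (d * d)           ∎

      neg-inverse′ : ∀ n d → n + - n ≈ 0# → (n * d + - n * d) * 1# ≈ 0# * (d * d)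
      neg-inverse′ n d e =
        trans (*-congʳ (+-comm (n * d) (- n * d))) (neg-inverse n d (-‿inverseˡ n))

    private module Q = CommutativeRing fractionRing

    S⁻¹R : Mod
    S⁻¹R = record
      { Carrierᴹ = Fraction
      ; _≈ᴹ_     = _≃_
      ; _+ᴹ_     = Q._+_
      ; _*ₗ_     = scale
      ; _*ᵣ_     = λ x r → scale r x
      ; 0ᴹ       = Q.0#
      ; -ᴹ_      = Q.-_
      ; isModule = IsModuleFromLeft.isModule record { isLeftModule = record
        { isLeftSemimodule = record
          { +ᴹ-isCommutativeMonoid = Q.+-isCommutativeMonoid
          ; isPreleftSemimodule = record
            { *ₗ-cong      = λ {r} {r′} {x} {y} → scale-cong {r} {r′} {x} {y}
            ; *ₗ-zeroˡ     = λ (frac n d _) → cross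
                (solve 2 (λ n d → con 0 :* n :* con 1 := con 0 :* d) refl n d)
            ; *ₗ-distribʳ  = λ (frac n d _) r s → cross
                (solve 4 (λ n d r s → (r :+ s) :* n :* (d :* d) :=
                                      (r :* n :* d :+ s :* n :* d) :* d) refl n d r s)
            ; *ₗ-identityˡ = λ (frac n d _) → cross (*-congʳ (*-identityˡ n))
            ; *ₗ-assoc     = λ r s (frac n d _) → cross (*-congʳ (*-assoc r s n))
            ; *ₗ-zeroʳ     = λ r → cross (*-congʳ (zeroʳ r))
            ; *ₗ-distribˡ  = λ r (frac n d _) (frac n′ d′ _) → cross
                (solve 5 (λ r n d n′ d′ →
                  r :* (n :* d′ :+ n′ :* d) :* (d :* d′) :=
                  (r :* n :* d′ :+ r :* n′ :* d) :* (d :* d′)) refl r n d n′ d′)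
            }
          }
        ; -ᴹ‿cong    = λ {x} {y} → Q.-‿cong {x} {y}
        ; -ᴹ‿inverse = Q.-‿inverse
        } }
      }
      where
      scale : Carrier → Fraction → Fraction
      scale r x = frac (r * num x) (den x) (den∈S x)

      scale-cong : ∀ {r r′ x y} → r ≈ r′ → x ≃ y → scale r x ≃ scale r′ y
      scale-cong {r} {r′} {frac n d _} {frac m e _} p (witness t t∈ q) = witness t t∈ (begin
        t * (r * n * e)   ≈⟨ solve 4 (λ t r n e → t :* (r :* n :* e) := r :* (t :* (n :* e))) refl t r n e ⟩
        r * (t * (n * e)) ≈⟨ *-cong p q ⟩
        r′ * (t * (m * d)) ≈⟨ solve 4 (λ t r n e → r :* (t :* (n :* e)) := t :* (r :* n :* e)) refl t r′ m d ⟩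
        t * (r′ * m * d)  ∎)

    private module L = Module S⁻¹R

    scale-*ˡ : ∀ r x y → ((r L.*ₗ x) Q.* y) ≃ (r L.*ₗ (x Q.* y))
    scale-*ˡ r (frac n d _) (frac m e _) = cross (*-congʳ (*-assoc r n m))

    -- The canonical map R → S⁻¹R, r ↦ r/1.
    ι : Hom ⟨module⟩ S⁻¹R
    ι = linear {⟨module⟩} {S⁻¹R} (λ r → frac r 1# 1∈S)
      (λ e → cross (*-congʳ e))
      (λ r s → cross (solve 2 (λ r s → (r :+ s) :* (con 1 :* con 1) :=
                                       (r :* con 1 :+ s :* con 1) :* con 1) refl r s))
      (λ r s → Q.refl)

    _·_ : Submodule S⁻¹R → Submodule S⁻¹R → Submodule S⁻¹R
    I · J = span S⁻¹R λ z → ∃[ x ] ∃[ y ] Mem I x × Mem J y × z ≃ (x Q.* y)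

    -- R · 1, the image of R in S⁻¹R.
    unit : Submodule S⁻¹R
    unit = span S⁻¹R (_≃ Q.1#)

    colon : Submodule S⁻¹R → Fraction → Submodule S⁻¹R
    colon N y = record
      { Mem       = λ x → Mem N (x Q.* y)
      ; resp      = λ {x} {x′} e → N.resp (Q.*-congʳ {y} {x} {x′} e)
      ; 0-closed  = N.resp (Q.sym (Q.zeroˡ y)) N.0-closed
      ; +-closed  = λ p q → N.resp (Q.sym (Q.distribʳ y _ _)) (N.+-closed p q)
      ; *ₗ-closed = λ r {x} p → N.resp (Q.sym (scale-*ˡ r x y)) (N.*ₗ-closed r p)
      }
      where module N = Submodule N

    *-mem : ∀ I J {x y} → Mem I x → Mem J y → Mem (I · J) (x Q.* y)
    *-mem I J p q = gen (_ , _ , p , q , Q.refl)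

    ·-least : ∀ I J N → (∀ {x y} → Mem I x → Mem J y → Mem N (x Q.* y)) →
              ∀ {z} → Mem (I · J) z → Mem N z
    ·-least I J N f = span-least S⁻¹R N
      λ (x , y , p , q , e) → Submodule.resp N (Q.sym e) (f p q)

    ·-mono : ∀ I I′ J J′ → (∀ {x} → Mem I x → Mem I′ x) → (∀ {x} → Mem J x → Mem J′ x) →
             ∀ {z} → Mem (I · J) z → Mem (I′ · J′) z
    ·-mono I I′ J J′ f g = ·-least I J (I′ · J′) λ p q → *-mem I′ J′ (f p) (g q)

    ·-comm : ∀ I J {z} → Mem (I · J) z → Mem (J · I) z
    ·-comm I J = ·-least I J (J · I) λ {x} {y} p q →
      resp∈ (Q.*-comm y x) (*-mem J I q p)

    ·-assocʳ : ∀ I J K {z} → Mem ((I · J) · K) z → Mem (I · (J · K)) z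
    ·-assocʳ I J K = ·-least (I · J) K T λ {_} {k} p k∈ →
      ·-least I J (colon T k) (λ {i} {j} i∈ j∈ →
        resp∈ (Q.sym (Q.*-assoc i j k)) (*-mem I (J · K) i∈ (*-mem J K j∈ k∈))) p
      where T = I · (J · K)

    ·-assocˡ : ∀ I J K {z} → Mem (I · (J · K)) z → Mem ((I · J) · K) z
    ·-assocˡ I J K p =
      ·-comm K (I · J) (·-mono K K (J · I) (I · J) (λ q → q) (·-comm J I)
        (·-assocʳ K J I (·-mono (J · K) (K · J) I I (·-comm J K) (λ q → q)
          (·-comm I (J · K) p))))

    unit-identity : ∀ I {z} → Mem (unit · I) z → Mem I z
    unit-identity I = ·-least unit I I λ {_} {y} p y∈ →
      span-least S⁻¹R (colon I y)
        (λ {x} e → Submodule.resp I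
          (Q.sym (Q.trans (Q.*-congʳ {y} {x} {Q.1#} e) (Q.*-identityˡ y))) y∈) p

    identity-unit : ∀ I {z} → Mem I z → Mem (unit · I) z
    identity-unit I {z} p = resp∈ (Q.*-identityˡ z) (*-mem unit I (gen Q.refl) p)

    unit-fg : IsFinitelyGeneratedSubmodule S⁻¹R unit
    unit-fg = 1 , (λ _ → Q.1#)
      , span-least S⁻¹R (span S⁻¹R _) (λ e → gen (fzero , e))
      , range-least S⁻¹R unit (λ _ → gen Q.refl)

    ·-fg : ∀ I J → IsFinitelyGeneratedSubmodule S⁻¹R I → IsFinitelyGeneratedSubmodule S⁻¹R J →
           IsFinitelyGeneratedSubmodule S⁻¹R (I · J)
    ·-fg I J (m , g , I⊆ , ⊆I) (n , g′ , J⊆ , ⊆J) =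
      m *ℕ n , G , ·-least I J ⟨G⟩ to , range-least S⁻¹R (I · J) from
      where
      G : Fin (m *ℕ n) → Fraction
      G k = g (proj₁ (remQuot {m} n k)) Q.* g′ (proj₂ (remQuot {m} n k))

      ⟨G⟩ : Submodule S⁻¹R
      ⟨G⟩ = span S⁻¹R (range S⁻¹R G)

      from : ∀ k → Mem (I · J) (G k)
      from k = *-mem I J (⊆I (gen-range S⁻¹R _)) (⊆J (gen-range S⁻¹R _))

      G∈ : ∀ i j → Mem ⟨G⟩ (g i Q.* g′ j)
      G∈ i j = ≡.subst (λ (i , j) → Mem ⟨G⟩ (g i Q.* g′ j)) (Finₚ.remQuot-combine i j)
                 (gen-range S⁻¹R (combine i j))

      to : ∀ {x y} → Mem I x → Mem J y → Mem ⟨G⟩ (x Q.* y)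
      to {x} {y} p q = range-least S⁻¹R (colon ⟨G⟩ y) (λ i →
        resp∈ (Q.*-comm y (g i)) (range-least S⁻¹R (colon ⟨G⟩ (g i)) (λ j →
          resp∈ (Q.*-comm (g i) (g′ j)) (G∈ i j)) (J⊆ q))) (I⊆ p)

    -- Finitely generated R-submodules of S⁻¹R, identified when they have the
    -- same elements.
    Ω : CommutativeMonoid (Level.suc ℓ) ℓ
    Ω = record
      { Carrier = Σ (Submodule S⁻¹R) (IsFinitelyGeneratedSubmodule S⁻¹R)
      ; _≈_     = λ (I , _) (J , _) → Mem I ≐ Mem J
      ; _∙_     = λ (I , p) (J , q) → I · J , ·-fg I J p q
      ; ε       = unit , unit-fg
      ; isCommutativeMonoid = record
        { isMonoid = record
          { isSemigroup = record
            { isMagma = record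
              { isEquivalence = record
                { refl  = (λ p → p) , (λ p → p)
                ; sym   = λ (f , g) → g , f
                ; trans = λ (f , g) (f′ , g′) → (λ p → f′ (f p)) , (λ p → g (g′ p))
                }
              ; ∙-cong = λ {(I , _)} {(I′ , _)} {(J , _)} {(J′ , _)} (f , g) (f′ , g′) →
                  ·-mono I I′ J J′ f f′ , ·-mono I′ I J′ J g g′
              }
            ; assoc = λ (I , _) (J , _) (K , _) → ·-assocʳ I J K , ·-assocˡ I J K
            }
          ; identity = (λ (I , _) → unit-identity I , identity-unit I)
                     , (λ (I , _) → (λ p → unit-identity I (·-comm I unit p))
                                  , (λ p → ·-comm unit I (identity-unit I p)))
          }
        ; comm = λ (I , _) (J , _) → ·-comm I J , ·-comm J I
        }
      }

module Fitting {ℓ : Level} (R : CommutativeRing ℓ ℓ) (S : Pred (CommutativeRing.Carrier R) ℓ) where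
  open CommutativeRing R using (Carrier)
  open Modules R
  open Localization R

  IsTorsion : Mod → Set ℓ
  IsTorsion M = ∀ x → ∃[ s ] S s × s *ₗ x ≈ᴹ 0ᴹ
    where open Module M

  -- Objects only: morphisms of 𝓜 are all R-linear maps.
  record 𝓜 : Set (Level.suc ℓ) where
    field
      underlying        : Mod
      finitelyGenerated : IsFinitelyGenerated underlying
      torsion           : IsTorsion underlying

  open 𝓜 public using (underlying)

  𝓟 : Pred 𝓜 (Level.suc ℓ)
  𝓟 P = ProjectiveDimension≤1 (underlying P)

  record IsFittingInvariant {c ℓ′} (Ω : CommutativeMonoid c ℓ′)
                            (𝓕 : 𝓜 → CommutativeMonoid.Carrier Ω) :
                            Set (Level.suc ℓ Level.⊔ c Level.⊔ ℓ′) where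
    open CommutativeMonoid Ω using (_≈_; _∙_; ε)
    field
      invertible     : ∀ P → 𝓟 P → Invertible _≈_ ε _∙_ (𝓕 P)
      multiplicative : ∀ M′ M P → 𝓟 P →
                       (f : Hom (underlying M′) (underlying M)) (g : Hom (underlying M) (underlying P)) →
                       IsShortExact f g → 𝓕 M ≈ 𝓕 P ∙ 𝓕 M′

  -- Fitt_R as an element of Ω: the minors are taken from the presentation
  -- given by the generators of M and by generators of their module of
  -- relations, which exist since R is noetherian.
  Fitt : IsNoetherian → (mult : IsMultiplicative S) → 𝓜 → CommutativeMonoid.Carrier (Ω S mult)
  Fitt noetherian mult M =
    image (ι S mult) (fittingIdeal presentation) ,
    image-fg (ι S mult) {fittingIdeal presentation} (fittingIdeal-fg presentation)
    where presentation = finitePresentation noetherian (𝓜.finitelyGenerated M)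

{-# OPTIONS --safe #-}
module Submission where

open import Defs
open import Level using (Level)
open import Algebra.Bundles using (CommutativeRing; CommutativeMonoid)
open import Relation.Unary using (Pred)
open import Algebra.Definitions using (Invertible)
open import Algebra.Module.Bundles using (Module)
open import Algebra.Module.Construct.TensorUnit using (⟨module⟩)
open import Algebra.Module.Structures.Biased using (IsModuleFromLeft)
import Algebra.Properties.Ring as RingProperties
import Algebra.Properties.AbelianGroup as AbelianGroupProperties
import Algebra.Properties.CommutativeSemigroup as CommutativeSemigroupProperties
import Algebra.Properties.Semiring.Exp as Exp
import Algebra.Properties.Semiring.Sum as SumProperties
import Algebra.Solver.Ring.NaturalCoefficients.Default as RingSolver
open import Data.Fin.Base using (Fin; toℕ; punchIn; splitAt; join; _↑ˡ_; _↑ʳ_)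
  renaming (zero to fzero; suc to fsuc)
import Data.Fin.Properties as Finₚ
open import Data.Nat.Base using (ℕ; zero; suc; _≤_; z≤n; s≤s) renaming (_+_ to _+ℕ_)
open import Data.Nat.Properties using (≤-refl; ≤-trans; n≤1+n)
open import Data.Product.Base using (Σ; ∃-syntax; _×_; _,_; proj₁; proj₂)
open import Data.Sum.Base using (inj₁; inj₂; [_,_]′)
open import Data.Unit.Polymorphic.Base using (⊤; tt)
open import Data.Vec.Functional using (Vector; _∷_; _++_; head; tail)
open import Data.Vec.Functional.Properties using (lookup-++ʳ; lookup-++ˡ)
open import Function.Base using (_∘_)
open import Function.Bundles using (Equivalence)
open import Relation.Binary.PropositionalEquality.Core as ≡ using (_≡_)
import Relation.Binary.Reasoning.Setoid as SetoidReasoning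

-- Write Fitt(M) as the ideal spanned by det V for all square V with columns in
-- the kernel of a free cover of M. Determinants of such matrices are controlled
-- by three facts on alternating forms: they are combinations of minors
-- (Cauchy–Binet), they are multiples of det in top degree, and they are
-- invariant under row operations.
--
-- If pd P ≤ 1, the relation module K of P is projective, and some s ∈ S kills P,
-- so s Rᵃ ⊆ K.
-- * A section of Rᵇ → K gives B with h B = s. By Cauchy–Binet sᵃ = det (h B) is a
--   sum of products of maximal minors of h and of B, and the products of the
--   minors of h with those of B are divisible by sᵃ since B maps K into s Rᵇ.
--   Hence s⁻ᵃ (sᵃ : Fitt P) is inverse to Fitt P.
-- * Relations of P lift linearly to relations of M. Over R[s⁻¹] this lift is a
--   matrix, so row operations bring the relation matrix of M into a block form
--   whose determinants are sums of products from Fitt M′ and Fitt P; the power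
--   of s introduced on the way is cancelled.

-- The relation module K of P need not be free, so P need not have a square presentation, and no
-- localization at primes is made to supply one. Projectivity of K serves only to lift maps out of
-- K. Precomposed with multiplication by s, such maps are maps of free modules, to which
-- determinants apply. A factor s in each of k vectors gives the k-th power of s, whence the powers
-- to be inverted or cancelled.
--
-- `Fitt` uses presentations chosen separately for each module, so those of M′, M and P are
-- unrelated. Taking all relation columns removes the dependence on the matrix h, and
-- `change-of-generators` the dependence on the generators.
--
-- Relations are columns, while a linear map between columns acts by row operations. The determinant
-- must thus alternate in both directions, although `det` only expands along the first row. Reading
-- that expansion as an exterior product with a functional settles both, and uniqueness in top
-- degree identifies the two forms.

module AlternatingForms {ℓ : Level} (R : CommutativeRing ℓ ℓ) where
  open CommutativeRing R hiding (zero)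
  open Modules R
  open RingProperties ring using (-1*x≈-x; -‿distribʳ-*)
  open AbelianGroupProperties +-abelianGroup using (⁻¹-∙-comm; inverseˡ-unique)
    renaming (ε⁻¹≈ε to -0#≈0#; ⁻¹-involutive to -‿involutive)
  open CommutativeSemigroupProperties +-commutativeSemigroup using ()
    renaming (interchange to +-interchange; x∙yz≈y∙xz to +-swap)
  open CommutativeSemigroupProperties *-commutativeSemigroup using ()
    renaming (x∙yz≈y∙xz to *-swap)
  open Exp semiring using () renaming (_^_ to _^ᴿ_)
  open SumProperties semiring using (∑-distrib-+; *-distribˡ-sum; sum-replicate-zero)
  open SetoidReasoning setoid

  a+-[a-b]≈b : ∀ a b → a + - (a + - b) ≈ b
  a+-[a-b]≈b a b = begin
    a + - (a + - b)      ≈⟨ +-congˡ (⁻¹-∙-comm a (- b)) ⟨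
    a + (- a + - - b)    ≈⟨ +-assoc a _ _ ⟨
    (a + - a) + - - b    ≈⟨ +-cong (-‿inverseʳ a) (-‿involutive b) ⟩
    0# + b               ≈⟨ +-identityˡ b ⟩
    b                    ∎

  -- Alternating forms on a module.

  Form : Mod → ℕ → Set ℓ
  Form V m = Vector (Module.Carrierᴹ V) m → Carrier

  module _ {V : Mod} where
    open Module V

    infix 4 _≋_ _≗_

    _≋_ : ∀ {m} → Vector Carrierᴹ m → Vector Carrierᴹ m → Set ℓ
    A ≋ B = ∀ i → A i ≈ᴹ B i

    _≗_ : ∀ {m} → Form V m → Form V m → Set ℓ
    f ≗ g = ∀ A → f A ≈ g A

    Respects : ∀ {m} → Form V m → Set ℓ
    Respects f = ∀ {A B} → A ≋ B → f A ≈ f B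

    ∷-cong : ∀ {m u v} {A B : Vector Carrierᴹ m} → u ≈ᴹ v → A ≋ B → u ∷ A ≋ v ∷ B
    ∷-cong u≈v A≋B fzero    = u≈v
    ∷-cong u≈v A≋B (fsuc i) = A≋B i

    ≋-refl : ∀ {m} {A : Vector Carrierᴹ m} → A ≋ A
    ≋-refl i = ≈ᴹ-refl

    ∷-head-tail : ∀ {m} (A : Vector Carrierᴹ (suc m)) → A ≋ head A ∷ tail A
    ∷-head-tail A fzero    = ≈ᴹ-refl
    ∷-head-tail A (fsuc i) = ≈ᴹ-refl

    -- The split on arity lets `step` cover forms in one argument, which have no second argument to
    -- compare with the first.
    VanishesOn : ∀ {m} → Carrierᴹ → Form V m → Set ℓ
    VanishesOn {zero}  v f = ⊤
    VanishesOn {suc m} v f = ∀ A → f (v ∷ A) ≈ 0#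

    -- Alternation is only demanded of the first two arguments, but for every
    -- form obtained by fixing an initial segment of the arguments.
    data Alternating : ∀ {m} → Form V m → Set ℓ where
      nullary : {f : Form V 0} → Respects f → Alternating f
      step    : ∀ {m} {f : Form V (suc m)} → Respects f →
                (∀ u v A → f (u +ᴹ v ∷ A) ≈ f (u ∷ A) + f (v ∷ A)) →
                (∀ r v A → f (r *ₗ v ∷ A) ≈ r * f (v ∷ A)) →
                (∀ v → Alternating (λ A → f (v ∷ A))) →
                (∀ v → VanishesOn v (λ A → f (v ∷ A))) →
                Alternating f

    alternating-respects : ∀ {m} {f : Form V m} → Alternating f → Respects f
    alternating-respects (nullary r)      = r
    alternating-respects (step r _ _ _ _) = r

    vanishes-cong : ∀ {m} {f g : Form V m} → f ≗ g → ∀ v → VanishesOn v f → VanishesOn v g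
    vanishes-cong {zero}  f≗g v p   = tt
    vanishes-cong {suc m} f≗g v p A = trans (sym (f≗g _)) (p A)

    alternating-cong : ∀ {m} {f g : Form V m} → f ≗ g → Alternating f → Alternating g
    alternating-cong f≗g (nullary r) =
      nullary λ e → trans (sym (f≗g _)) (trans (r e) (f≗g _))
    alternating-cong f≗g (step r add scale fix alt) = step
      (λ e → trans (sym (f≗g _)) (trans (r e) (f≗g _)))
      (λ u v A → trans (sym (f≗g _)) (trans (add u v A) (+-cong (f≗g _) (f≗g _))))
      (λ r v A → trans (sym (f≗g _)) (trans (scale r v A) (*-congˡ (f≗g _))))
      (λ v → alternating-cong (λ A → f≗g _) (fix v))
      (λ v → vanishes-cong (λ A → f≗g _) v (alt v))

    alternating-+ : ∀ {m} {f g : Form V m} → Alternating f → Alternating g →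
                    Alternating (λ A → f A + g A)
    alternating-+ (nullary r) (nullary r′) = nullary λ e → +-cong (r e) (r′ e)
    alternating-+ (step r add scale fix alt) (step r′ add′ scale′ fix′ alt′) = step
      (λ e → +-cong (r e) (r′ e))
      (λ u v A → trans (+-cong (add u v A) (add′ u v A)) (+-interchange _ _ _ _))
      (λ r v A → trans (+-cong (scale r v A) (scale′ r v A)) (sym (distribˡ r _ _)))
      (λ v → alternating-+ (fix v) (fix′ v))
      (λ v → vanishes-+ v (alt v) (alt′ v))
      where
      vanishes-+ : ∀ {m} {f g : Form V m} v → VanishesOn v f → VanishesOn v g →
                   VanishesOn v (λ A → f A + g A)
      vanishes-+ {zero}  v p q   = tt
      vanishes-+ {suc m} v p q A = trans (+-cong (p A) (q A)) (+-identityˡ 0#)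

    alternating-* : ∀ {m} {f : Form V m} c → Alternating f → Alternating (λ A → c * f A)
    alternating-* c (nullary r) = nullary λ e → *-congˡ (r e)
    alternating-* c (step r add scale fix alt) = step
      (λ e → *-congˡ (r e))
      (λ u v A → trans (*-congˡ (add u v A)) (distribˡ c _ _))
      (λ r v A → trans (*-congˡ (scale r v A)) (*-swap c r _))
      (λ v → alternating-* c (fix v))
      (λ v → vanishes-* v (alt v))
      where
      vanishes-* : ∀ {m} {f : Form V m} v → VanishesOn v f → VanishesOn v (λ A → c * f A)
      vanishes-* {zero}  v p   = tt
      vanishes-* {suc m} v p A = trans (*-congˡ (p A)) (zeroʳ c)

    alternating-‿ : ∀ {m} {f : Form V m} → Alternating f → Alternating (λ A → - f A)
    alternating-‿ alt = alternating-cong (λ A → -1*x≈-x _) (alternating-* (- 1#) alt)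

    alternating-0 : ∀ {m} → Alternating {m} (λ A → 0#)
    alternating-0 {zero}  = nullary λ _ → refl
    alternating-0 {suc m} = step (λ _ → refl) (λ _ _ _ → sym (+-identityˡ 0#))
      (λ r _ _ → sym (zeroʳ r)) (λ _ → alternating-0) (λ v → vanishes-0 v)
      where
      vanishes-0 : ∀ {m} v → VanishesOn {m} v (λ A → 0#)
      vanishes-0 {zero}  v   = tt
      vanishes-0 {suc m} v A = refl

    alternating-sum : ∀ {m n} {f : Fin n → Form V m} → (∀ j → Alternating (f j)) →
                      Alternating (λ A → sum λ j → f j A)
    alternating-sum {n = zero}  alt = alternating-0
    alternating-sum {n = suc n} alt = alternating-+ (alt fzero) (alternating-sum (alt ∘ fsuc))

    alternating-zero : ∀ {m} {f : Form V (suc m)} → Alternating f →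
                       ∀ {v} A → v ≈ᴹ 0ᴹ → f (v ∷ A) ≈ 0#
    alternating-zero {f = f} (step r add scale fix alt) {v} A v≈0 = begin
      f (v ∷ A)        ≈⟨ r (∷-cong (≈ᴹ-trans v≈0 (≈ᴹ-sym (*ₗ-zeroˡ v))) ≋-refl) ⟩
      f (0# *ₗ v ∷ A)  ≈⟨ scale 0# v A ⟩
      0# * f (v ∷ A)   ≈⟨ zeroˡ _ ⟩
      0#               ∎

    -- Polarization: expand the value on (u + v, u + v), which is zero. Additivity in the second
    -- slot is that of the form with its first argument fixed.
    alternating-swap : ∀ {m} {f : Form V (suc (suc m))} → Alternating f →
                       ∀ u v A → f (u ∷ v ∷ A) ≈ - f (v ∷ u ∷ A)
    alternating-swap {f = f} (step r add scale fix alt) u v A =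
      inverseˡ-unique _ _ (begin
        f (u ∷ v ∷ A) + f (v ∷ u ∷ A)
          ≈⟨ +-cong (+-identityˡ _) (+-identityʳ _) ⟨
        (0# + f (u ∷ v ∷ A)) + (f (v ∷ u ∷ A) + 0#)
          ≈⟨ +-cong (+-congʳ (alt u A)) (+-congˡ (alt v A)) ⟨
        (f (u ∷ u ∷ A) + f (u ∷ v ∷ A)) + (f (v ∷ u ∷ A) + f (v ∷ v ∷ A))
          ≈⟨ +-cong (add₂ u) (add₂ v) ⟨
        f (u ∷ u +ᴹ v ∷ A) + f (v ∷ u +ᴹ v ∷ A)
          ≈⟨ add u v _ ⟨
        f (u +ᴹ v ∷ u +ᴹ v ∷ A)
          ≈⟨ alt (u +ᴹ v) A ⟩
        0# ∎)
      where
      add₂ : ∀ w → f (w ∷ u +ᴹ v ∷ A) ≈ f (w ∷ u ∷ A) + f (w ∷ v ∷ A)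
      add₂ w with fix w
      ... | step _ add _ _ _ = add u v A

    -- Swapping v past A 0 and then fixing A 0 leaves a form with one argument fewer, in which the
    -- equal entry is one place nearer.
    alternating-repeat : ∀ {m} {f : Form V (suc m)} → Alternating f →
                         ∀ {v} A i → v ≈ᴹ A i → f (v ∷ A) ≈ 0#
    alternating-repeat {suc m} {f} (step r add scale fix alt) {v} A fzero v≈ = begin
      f (v ∷ A)          ≈⟨ r (∷-cong ≈ᴹ-refl (∷-head-tail A)) ⟩
      f (v ∷ A fzero ∷ tail A)
        ≈⟨ r (∷-cong ≈ᴹ-refl (∷-cong (≈ᴹ-sym v≈) ≋-refl)) ⟩
      f (v ∷ v ∷ tail A) ≈⟨ alt v (tail A) ⟩
      0#                 ∎
    alternating-repeat {suc m} {f} F@(step r add scale fix alt) {v} A (fsuc i) v≈ = begin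
      f (v ∷ A)                    ≈⟨ r (∷-cong ≈ᴹ-refl (∷-head-tail A)) ⟩
      f (v ∷ A fzero ∷ tail A)     ≈⟨ alternating-swap F v (A fzero) (tail A) ⟩
      - f (A fzero ∷ v ∷ tail A)
        ≈⟨ -‿cong (alternating-repeat (fix (A fzero)) (tail A) i v≈) ⟩
      - 0#                         ≈⟨ -0#≈0# ⟩
      0#                           ∎

    alternating-dependent : ∀ {m} {f : Form V (suc m)} → Alternating f →
                            ∀ {v} A → Span V (range V A) v → f (v ∷ A) ≈ 0#
    alternating-dependent {f = f} F@(step r add scale fix alt) A = range-least V
      (record
        { Mem       = λ v → f (v ∷ A) ≈ 0#
        ; resp      = λ e p → trans (r (∷-cong (≈ᴹ-sym e) ≋-refl)) p
        ; 0-closed  = alternating-zero F A ≈ᴹ-refl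
        ; +-closed  = λ p q → trans (add _ _ A) (trans (+-cong p q) (+-identityˡ 0#))
        ; *ₗ-closed = λ s p → trans (scale s _ A) (trans (*-congˡ p) (zeroʳ s))
        })
      (λ i → alternating-repeat F A i ≈ᴹ-refl)

    ∷-++ : ∀ {m n} v (Z : Vector Carrierᴹ m) (Y : Vector Carrierᴹ n) →
           (v ∷ Z) ++ Y ≋ v ∷ (Z ++ Y)
    ∷-++ v Z Y fzero = ≈ᴹ-refl
    ∷-++ {m} v Z Y (fsuc i) with splitAt m i
    ... | inj₁ j = ≈ᴹ-refl
    ... | inj₂ j = ≈ᴹ-refl

    ++-cong : ∀ {m n} {Z Z′ : Vector Carrierᴹ m} {Y Y′ : Vector Carrierᴹ n} →
              Z ≋ Z′ → Y ≋ Y′ → Z ++ Y ≋ Z′ ++ Y′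
    ++-cong {m} p q i with splitAt m i
    ... | inj₁ j = p j
    ... | inj₂ j = q j

    -- With `alternating-final`, a form on a stack of two blocks becomes a form in either block, so
    -- that top-degree uniqueness, minors and scaling apply blockwise.
    alternating-initial : ∀ {m n} {f : Form V (m +ℕ n)} → Alternating f →
                          ∀ (Y : Vector Carrierᴹ n) → Alternating (λ Z → f (Z ++ Y))
    alternating-initial {zero} F Y =
      nullary λ p → alternating-respects F (++-cong p ≋-refl)
    alternating-initial {suc m} {f = f} (step r add scale fix alt) Y = step
      (λ p → r (++-cong p ≋-refl))
      (λ u v Z → trans (r (∷-++ _ Z Y)) (trans (add u v _)
        (+-cong (sym (r (∷-++ u Z Y))) (sym (r (∷-++ v Z Y))))))
      (λ s v Z → trans (r (∷-++ _ Z Y)) (trans (scale s v _) (*-congˡ (sym (r (∷-++ v Z Y))))))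
      (λ v → alternating-cong (λ Z → r (λ i → ≈ᴹ-sym (∷-++ v Z Y i)))
               (alternating-initial (fix v) Y))
      (λ v → vanishes-cong (λ Z → r (λ i → ≈ᴹ-sym (∷-++ v Z Y i))) v
               (vanishes-initial v (alternating-respects (fix v)) (alt v)))
      where
      vanishes-initial : ∀ {m} {f : Form V (m +ℕ _)} v → Respects f → VanishesOn v f →
                         VanishesOn v (λ Z → f (Z ++ Y))
      vanishes-initial {zero}  v r p   = tt
      vanishes-initial {suc m} v r p Z = trans (r (∷-++ v Z Y)) (p (Z ++ Y))

    alternating-final : ∀ {m n} {f : Form V (m +ℕ n)} → Alternating f →
                        ∀ (Z : Vector Carrierᴹ m) → Alternating (λ Y → f (Z ++ Y))
    alternating-final {zero} F Z = F
    alternating-final {suc m} {f = f} (step r add scale fix alt) Z =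
      alternating-cong (λ Y → r λ i → ≈ᴹ-trans (≈ᴹ-sym (∷-++ (head Z) (tail Z) Y i))
                                         (++-cong (λ j → ≈ᴹ-sym (∷-head-tail Z j)) ≋-refl i))
        (alternating-final (fix (head Z)) (tail Z))

    alternating-scale : ∀ {m} {f : Form V m} → Alternating f →
                        ∀ s A → f (λ j → s *ₗ A j) ≈ s ^ᴿ m * f A
    alternating-scale (nullary r) s A = trans (r λ ()) (sym (*-identityˡ _))
    alternating-scale {suc m} {f} (step r add scale fix alt) s A = begin
      f (λ j → s *ₗ A j)                       ≈⟨ r (∷-head-tail _) ⟩
      f (s *ₗ head A ∷ λ j → s *ₗ tail A j)    ≈⟨ scale s _ _ ⟩
      s * f (head A ∷ λ j → s *ₗ tail A j)
        ≈⟨ *-congˡ (alternating-scale (fix (head A)) s (tail A)) ⟩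
      s * (s ^ᴿ m * f (head A ∷ tail A))
        ≈⟨ *-assoc s _ _ ⟨
      s ^ᴿ suc m * f (head A ∷ tail A)
        ≈⟨ *-congˡ (r (∷-head-tail A)) ⟨
      s ^ᴿ suc m * f A ∎

    span-mono : ∀ {X Y : Pred Carrierᴹ ℓ} → (∀ {x} → X x → Y x) → ∀ {x} → Span V X x → Span V Y x
    span-mono X⊆Y = span-least V (span V _) (λ p → gen (X⊆Y p))

    -- One argument is changed at a time: the extra term contains D i together with all of Y, on
    -- which D i depends, so it vanishes.
    shear : ∀ {m n} {f : Form V (m +ℕ n)} → Alternating f →
            ∀ {Z D Z′ : Vector Carrierᴹ m} {Y : Vector Carrierᴹ n} →
            (∀ i → Z′ i ≈ᴹ Z i +ᴹ D i) → (∀ i → Span V (range V Y) (D i)) →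
            f (Z′ ++ Y) ≈ f (Z ++ Y)
    shear {zero}  F _ _ = alternating-respects F λ i → ≈ᴹ-refl
    shear {suc m} {n} {f} F@(step r add scale fix alt) {Z} {D} {Z′} {Y} Z′≈ D∈ = begin
      f (Z′ ++ Y)
        ≈⟨ r (++-cong (∷-head-tail Z′) ≋-refl) ⟩
      f ((head Z′ ∷ tail Z′) ++ Y)
        ≈⟨ r (∷-++ (head Z′) (tail Z′) Y) ⟩
      f (head Z′ ∷ (tail Z′ ++ Y))
        ≈⟨ r (∷-cong (Z′≈ fzero) ≋-refl) ⟩
      f (head Z +ᴹ head D ∷ (tail Z′ ++ Y))
        ≈⟨ add (head Z) (head D) _ ⟩
      f (head Z ∷ (tail Z′ ++ Y)) + f (head D ∷ (tail Z′ ++ Y))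
        ≈⟨ +-congˡ (alternating-dependent F (tail Z′ ++ Y) (span-mono Y⊆ (D∈ fzero))) ⟩
      f (head Z ∷ (tail Z′ ++ Y)) + 0#
        ≈⟨ +-identityʳ _ ⟩
      f (head Z ∷ (tail Z′ ++ Y))
        ≈⟨ shear (fix (head Z)) (Z′≈ ∘ fsuc) (D∈ ∘ fsuc) ⟩
      f (head Z ∷ (tail Z ++ Y))
        ≈⟨ r (∷-++ (head Z) (tail Z) Y) ⟨
      f ((head Z ∷ tail Z) ++ Y)
        ≈⟨ r (++-cong (∷-head-tail Z) ≋-refl) ⟨
      f (Z ++ Y) ∎
      where
      Y⊆ : ∀ {x} → range V Y x → range V (tail Z′ ++ Y) x
      Y⊆ (j , x≈) = m ↑ʳ j , ≈ᴹ-trans x≈ (≈ᴹ-reflexive (≡.sym (lookup-++ʳ (tail Z′) Y j)))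

    -- Exterior product of a functional with a form.

    wedge-term : ∀ {m} → (Carrierᴹ → Carrier) → Form V m →
                 Vector Carrierᴹ (suc m) → Fin (suc m) → Carrier
    wedge-term φ f A j = ((- 1#) ^ᴿ toℕ j) * (φ (A j) * f (A ∘ punchIn j))

    -- This is φ ∧ f. In positive size `colDet` is by definition the case where φ is the first
    -- coordinate and f the determinant of the remaining rows.
    wedge : ∀ {m} → (Carrierᴹ → Carrier) → Form V m → Form V (suc m)
    wedge φ f A = sum (wedge-term φ f A)

    wedge-cong : ∀ {m} (φ : Carrierᴹ → Carrier) {f g : Form V m} → f ≗ g → wedge φ f ≗ wedge φ g
    wedge-cong φ f≗g A = sum-cong-≋ λ j →
      *-congˡ {(- 1#) ^ᴿ toℕ j} (*-congˡ {φ (A j)} (f≗g (A ∘ punchIn j)))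

    wedge-congˡ : ∀ {m} {φ ψ : Carrierᴹ → Carrier} (f : Form V m) {A} →
                  (∀ j → φ (A j) ≈ ψ (A j)) → wedge φ f A ≈ wedge ψ f A
    wedge-congˡ f {A} φ≈ψ = sum-cong-≋ λ j →
      *-congˡ {(- 1#) ^ᴿ toℕ j} (*-congʳ {f (A ∘ punchIn j)} (φ≈ψ j))

    wedge-+ : ∀ {m} (φ : Carrierᴹ → Carrier) (f g : Form V m) A →
              wedge φ (λ B → f B + g B) A ≈ wedge φ f A + wedge φ g A
    wedge-+ φ f g A = trans
      (sum-cong-≋ λ j → trans
        (*-congˡ {(- 1#) ^ᴿ toℕ j} (distribˡ (φ (A j)) (f (A ∘ punchIn j)) (g (A ∘ punchIn j))))
        (distribˡ _ _ _))
      (∑-distrib-+ (wedge-term φ f A) (wedge-term φ g A))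

    wedge-* : ∀ {m} (φ : Carrierᴹ → Carrier) c (f : Form V m) A →
              wedge φ (λ B → c * f B) A ≈ c * wedge φ f A
    wedge-* φ c f A = trans
      (sum-cong-≋ λ j → trans
        (*-congˡ {(- 1#) ^ᴿ toℕ j} (*-swap (φ (A j)) c (f (A ∘ punchIn j)))) (*-swap _ c _))
      (sym (*-distribˡ-sum c (wedge-term φ f A)))

    wedge-0 : ∀ {m} (φ : Carrierᴹ → Carrier) A → wedge {m} φ (λ _ → 0#) A ≈ 0#
    wedge-0 {m} φ A = trans
      (sum-cong-≋ {suc m} λ j → trans (*-congˡ {(- 1#) ^ᴿ toℕ j} (zeroʳ (φ (A j)))) (zeroʳ _))
      (sum-replicate-zero (suc m))

    wedge-‿ : ∀ {m} (φ : Carrierᴹ → Carrier) (f : Form V m) A →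
              wedge φ (λ B → - f B) A ≈ - wedge φ f A
    wedge-‿ φ f A = begin
      wedge φ (λ B → - f B) A        ≈⟨ wedge-cong φ (λ B → sym (-1*x≈-x (f B))) A ⟩
      wedge φ (λ B → - 1# * f B) A   ≈⟨ wedge-* φ (- 1#) f A ⟩
      - 1# * wedge φ f A             ≈⟨ -1*x≈-x _ ⟩
      - wedge φ f A                  ∎

    wedge-respects : ∀ {m} {φ : Carrierᴹ → Carrier} {f : Form V m} →
                     (∀ {u v} → u ≈ᴹ v → φ u ≈ φ v) → Respects f → Respects (wedge φ f)
    wedge-respects φ-cong r p =
      sum-cong-≋ λ j → *-congˡ {(- 1#) ^ᴿ toℕ j} (*-cong (φ-cong (p j)) (r (p ∘ punchIn j)))

    wedge-nullary : ∀ (φ : Carrierᴹ → Carrier) {f : Form V 0} → Respects f →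
                    ∀ v A → wedge φ f (v ∷ A) ≈ φ v * f A
    wedge-nullary φ r v A = trans (+-identityʳ _) (trans (*-identityˡ _) (*-congˡ (r λ ())))

    -- Contraction by v is an antiderivation: i_v (φ ∧ f) = φ(v) f - φ ∧ i_v f. The inductions on
    -- degree below rest on it.
    wedge-∷ : ∀ {m} (φ : Carrierᴹ → Carrier) {f : Form V (suc m)} → Respects f →
              ∀ v A → wedge φ f (v ∷ A) ≈ φ v * f A + - wedge φ (λ B → f (v ∷ B)) A
    wedge-∷ φ {f} r v A = +-cong (*-identityˡ _) (begin
      sum (λ j → ((- 1#) ^ᴿ suc (toℕ j)) * (φ (A j) * f ((v ∷ A) ∘ punchIn (fsuc j))))
        ≈⟨ sum-cong-≋ (λ j → trans (*-assoc (- 1#) ((- 1#) ^ᴿ toℕ j) _)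
             (*-congˡ { - 1#} (*-congˡ {(- 1#) ^ᴿ toℕ j} (*-congˡ {φ (A j)}
               (r (∷-head-tail ((v ∷ A) ∘ punchIn (fsuc j)))))))) ⟩
      sum (λ j → - 1# * wedge-term φ (λ B → f (v ∷ B)) A j)
        ≈⟨ *-distribˡ-sum (- 1#) (wedge-term φ (λ B → f (v ∷ B)) A) ⟨
      - 1# * wedge φ (λ B → f (v ∷ B)) A
        ≈⟨ -1*x≈-x _ ⟩
      - wedge φ (λ B → f (v ∷ B)) A ∎)

    fix-respects : ∀ {m} {f : Form V (suc m)} → Respects f → ∀ v → Respects (λ A → f (v ∷ A))
    fix-respects r v p = r (∷-cong ≈ᴹ-refl p)

    -- This is φ ∧ φ = 0. With `wedge-∷` applied to both wedges, the terms φ(v) (φ ∧ f) cancel and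
    -- leave φ ∧ φ ∧ i_v f, of smaller degree.
    wedge-self : ∀ {m} (φ : Carrierᴹ → Carrier) → (∀ {u v} → u ≈ᴹ v → φ u ≈ φ v) →
                 {f : Form V m} → Respects f → ∀ A → wedge φ (wedge φ f) A ≈ 0#
    wedge-self {m} φ φ-cong {f} r A = trans
      (wedge-respects φ-cong rφ (∷-head-tail A))
      (go m r (head A) (tail A))
      where
      rφ : Respects (wedge φ f)
      rφ = wedge-respects φ-cong r
      go : ∀ m {f : Form V m} → Respects f → ∀ v A → wedge φ (wedge φ f) (v ∷ A) ≈ 0#
      go zero {f} r v A = begin
        wedge φ (wedge φ f) (v ∷ A)
          ≈⟨ wedge-∷ φ (wedge-respects φ-cong r) v A ⟩
        φ v * wedge φ f A + - wedge φ (λ B → wedge φ f (v ∷ B)) A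
          ≈⟨ +-congˡ (-‿cong (trans (wedge-cong φ (wedge-nullary φ r v) A) (wedge-* φ (φ v) f A))) ⟩
        φ v * wedge φ f A + - (φ v * wedge φ f A)
          ≈⟨ -‿inverseʳ _ ⟩
        0# ∎
      go (suc m) {f} r v A = begin
        wedge φ (wedge φ f) (v ∷ A)
          ≈⟨ wedge-∷ φ (wedge-respects φ-cong r) v A ⟩
        φ v * wedge φ f A + - wedge φ (λ B → wedge φ f (v ∷ B)) A
          ≈⟨ +-congˡ (-‿cong (wedge-cong φ (wedge-∷ φ r v) A)) ⟩
        φ v * wedge φ f A + - wedge φ (λ B → φ v * f B + - wedge φ (λ C → f (v ∷ C)) B) A
          ≈⟨ +-congˡ (-‿cong (trans (wedge-+ φ (λ B → φ v * f B) (λ B → - wedge φ (λ C → f (v ∷ C)) B) A)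
               (+-cong (wedge-* φ (φ v) f A) (wedge-‿ φ (wedge φ (λ C → f (v ∷ C))) A)))) ⟩
        φ v * wedge φ f A + - (φ v * wedge φ f A + - wedge φ (wedge φ (λ C → f (v ∷ C))) A)
          ≈⟨ a+-[a-b]≈b _ _ ⟩
        wedge φ (wedge φ (λ C → f (v ∷ C))) A
          ≈⟨ wedge-respects φ-cong (wedge-respects φ-cong (fix-respects r v)) (∷-head-tail A) ⟩
        wedge φ (wedge φ (λ C → f (v ∷ C))) (head A ∷ tail A)
          ≈⟨ go m (fix-respects r v) (head A) (tail A) ⟩
        0# ∎

    -- Fixing the first argument v gives φ(v) f - φ ∧ i_v f, alternating by induction. If the next
    -- argument is v too, i_v f vanishes on it, so φ ∧ i_v f contributes only its leading term,
    -- which cancels φ(v) f.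
    wedge-alternating : ∀ {m} (φ : Hom V ⟨module⟩) {f : Form V m} → Alternating f →
                        Alternating (wedge ⟦ φ ⟧ f)
    wedge-alternating {zero} φ {f} (nullary r) = step rφ
      (λ u v A → trans (∷-eq _ A) (trans (*-congʳ (Hom.+ᴹ-homo φ u v))
        (trans (distribʳ _ _ _) (sym (+-cong (∷-eq u A) (∷-eq v A))))))
      (λ s v A → trans (∷-eq _ A) (trans (*-congʳ (Hom.*ₗ-homo φ s v))
        (trans (*-assoc s _ _) (*-congˡ (sym (∷-eq v A))))))
      (λ v → nullary (fix-respects rφ v))
      (λ v → tt)
      where
      rφ : Respects (wedge ⟦ φ ⟧ f)
      rφ = wedge-respects (Hom.⟦⟧-cong φ) r
      ∷-eq : ∀ v A → wedge ⟦ φ ⟧ f (v ∷ A) ≈ ⟦ φ ⟧ v * f A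
      ∷-eq = wedge-nullary ⟦ φ ⟧ r
    wedge-alternating {suc m} φ {f} F@(step r add scale fix alt) = step rφ
      (λ u v A → begin
        wedge ⟦ φ ⟧ f (u +ᴹ v ∷ A)
          ≈⟨ ∷-eq _ A ⟩
        ⟦ φ ⟧ (u +ᴹ v) * f A + - wedge ⟦ φ ⟧ (λ B → f (u +ᴹ v ∷ B)) A
          ≈⟨ +-cong (trans (*-congʳ (Hom.+ᴹ-homo φ u v)) (distribʳ _ _ _))
               (trans (-‿cong (trans (wedge-cong ⟦ φ ⟧ (add u v) A)
                        (wedge-+ ⟦ φ ⟧ (λ B → f (u ∷ B)) (λ B → f (v ∷ B)) A)))
                 (sym (⁻¹-∙-comm _ _))) ⟩
        (⟦ φ ⟧ u * f A + ⟦ φ ⟧ v * f A) +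
          (- wedge ⟦ φ ⟧ (λ B → f (u ∷ B)) A + - wedge ⟦ φ ⟧ (λ B → f (v ∷ B)) A)
          ≈⟨ +-interchange _ _ _ _ ⟩
        (⟦ φ ⟧ u * f A + - wedge ⟦ φ ⟧ (λ B → f (u ∷ B)) A) +
          (⟦ φ ⟧ v * f A + - wedge ⟦ φ ⟧ (λ B → f (v ∷ B)) A)
          ≈⟨ +-cong (∷-eq u A) (∷-eq v A) ⟨
        wedge ⟦ φ ⟧ f (u ∷ A) + wedge ⟦ φ ⟧ f (v ∷ A) ∎)
      (λ s v A → begin
        wedge ⟦ φ ⟧ f (s *ₗ v ∷ A)
          ≈⟨ ∷-eq _ A ⟩
        ⟦ φ ⟧ (s *ₗ v) * f A + - wedge ⟦ φ ⟧ (λ B → f (s *ₗ v ∷ B)) A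
          ≈⟨ +-cong (trans (*-congʳ (Hom.*ₗ-homo φ s v)) (*-assoc s _ _))
               (trans (-‿cong (trans (wedge-cong ⟦ φ ⟧ (scale s v) A)
                        (wedge-* ⟦ φ ⟧ s (λ B → f (v ∷ B)) A)))
                 (-‿distribʳ-* s _)) ⟩
        s * (⟦ φ ⟧ v * f A) + s * - wedge ⟦ φ ⟧ (λ B → f (v ∷ B)) A
          ≈⟨ distribˡ s _ _ ⟨
        s * (⟦ φ ⟧ v * f A + - wedge ⟦ φ ⟧ (λ B → f (v ∷ B)) A)
          ≈⟨ *-congˡ (∷-eq v A) ⟨
        s * wedge ⟦ φ ⟧ f (v ∷ A) ∎)
      (λ v → alternating-cong (λ A → sym (∷-eq v A))
        (alternating-+ (alternating-* (⟦ φ ⟧ v) F) (alternating-‿ (wedge-alternating φ (fix v)))))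
      (λ v A → begin
        wedge ⟦ φ ⟧ f (v ∷ v ∷ A)
          ≈⟨ ∷-eq v (v ∷ A) ⟩
        ⟦ φ ⟧ v * f (v ∷ A) + - wedge ⟦ φ ⟧ (λ B → f (v ∷ B)) (v ∷ A)
          ≈⟨ +-congˡ (-‿cong (wedge-vanishing v (fix-respects r v) (alt v) A)) ⟩
        ⟦ φ ⟧ v * f (v ∷ A) + - (⟦ φ ⟧ v * f (v ∷ A))
          ≈⟨ -‿inverseʳ _ ⟩
        0# ∎)
      where
      rφ : Respects (wedge ⟦ φ ⟧ f)
      rφ = wedge-respects (Hom.⟦⟧-cong φ) r
      ∷-eq : ∀ v A → wedge ⟦ φ ⟧ f (v ∷ A) ≈ ⟦ φ ⟧ v * f A + - wedge ⟦ φ ⟧ (λ B → f (v ∷ B)) A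
      ∷-eq = wedge-∷ ⟦ φ ⟧ r
      wedge-vanishing : ∀ {m} {g : Form V m} v → Respects g → VanishesOn v g →
                        ∀ A → wedge ⟦ φ ⟧ g (v ∷ A) ≈ ⟦ φ ⟧ v * g A
      wedge-vanishing {zero}  v r p A = wedge-nullary ⟦ φ ⟧ r v A
      wedge-vanishing {suc m} {g} v r p A = begin
        wedge ⟦ φ ⟧ g (v ∷ A)
          ≈⟨ wedge-∷ ⟦ φ ⟧ r v A ⟩
        ⟦ φ ⟧ v * g A + - wedge ⟦ φ ⟧ (λ B → g (v ∷ B)) A
          ≈⟨ +-congˡ (trans (-‿cong (trans (wedge-cong ⟦ φ ⟧ p A) (wedge-0 {m} ⟦ φ ⟧ A))) -0#≈0#) ⟩
        ⟦ φ ⟧ v * g A + 0#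
          ≈⟨ +-identityʳ _ ⟩
        ⟦ φ ⟧ v * g A ∎

  -- Pullback of forms; the determinant as a form in its columns.

  alternating-pullback : ∀ {U V : Mod} (φ : Hom U V) {m} {f : Form V m} → Alternating {V} f →
                         Alternating {U} (λ A → f (⟦ φ ⟧ ∘ A))
  alternating-pullback {U} {V} φ (nullary r) = nullary λ p → r (Hom.⟦⟧-cong φ ∘ p)
  alternating-pullback {U} {V} φ {f = f} (step {m} r add scale fix alt) = step
    (λ p → r (Hom.⟦⟧-cong φ ∘ p))
    (λ u v A → trans (∷-eq _ A) (trans (r (∷-cong {V} (Hom.+ᴹ-homo φ u v) (≋-refl {V})))
      (trans (add _ _ _) (sym (+-cong (∷-eq u A) (∷-eq v A))))))
    (λ s v A → trans (∷-eq _ A) (trans (r (∷-cong {V} (Hom.*ₗ-homo φ s v) (≋-refl {V})))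
      (trans (scale s _ _) (*-congˡ (sym (∷-eq v A))))))
    (λ v → alternating-cong (λ A → sym (∷-eq v A)) (alternating-pullback φ (fix (⟦ φ ⟧ v))))
    (λ v → vanishes-cong {U} (λ A → sym (∷-eq v A)) v
             (vanishes-pullback v (alternating-respects (fix (⟦ φ ⟧ v))) (alt (⟦ φ ⟧ v))))
    where
    ∷-map : ∀ {m} v (A : Vector (Module.Carrierᴹ U) m) →
            _≋_ {V} (⟦ φ ⟧ ∘ (v ∷ A)) (⟦ φ ⟧ v ∷ (⟦ φ ⟧ ∘ A))
    ∷-map v A fzero    = Module.≈ᴹ-refl V
    ∷-map v A (fsuc i) = Module.≈ᴹ-refl V
    ∷-eq : ∀ v A → f (⟦ φ ⟧ ∘ (v ∷ A)) ≈ f (⟦ φ ⟧ v ∷ (⟦ φ ⟧ ∘ A))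
    ∷-eq v A = r (∷-map v A)
    vanishes-pullback : ∀ {m} {g : Form V m} v → Respects {V} g → VanishesOn {V} (⟦ φ ⟧ v) g →
                        VanishesOn {U} v (λ A → g (⟦ φ ⟧ ∘ A))
    vanishes-pullback {zero}  v r p   = tt
    vanishes-pullback {suc m} v r p A = trans (r (∷-map v A)) (p _)

  reindex : ∀ {m n} → (Fin m → Fin n) → Hom (Free n) (Free m)
  reindex {m} {n} σ = linear {Free n} {Free m} (_∘ σ) (_∘ σ) (λ _ _ _ → refl) (λ _ _ _ → refl)

  coordinate : ∀ {n} → Fin n → Hom (Free n) ⟨module⟩
  coordinate {n} i = linear {Free n} {⟨module⟩} (λ v → v i) (λ p → p i) (λ _ _ → refl) (λ _ _ → refl)

  0∷ : ∀ {n} → Hom (Free n) (Free (suc n))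
  0∷ {n} = linear {Free n} {Free (suc n)} (0# ∷_)
    (λ p → λ { fzero → refl ; (fsuc i) → p i })
    (λ v w → λ { fzero → sym (+-identityˡ 0#) ; (fsuc i) → refl })
    (λ r w → λ { fzero → sym (zeroʳ r) ; (fsuc i) → refl })

  colDet : ∀ {n} → Form (Free n) n
  colDet A = det (λ i j → A j i)

  minorForm : ∀ {m b} → (Fin m → Fin b) → Form (Free b) m
  minorForm σ A = colDet (λ j → A j ∘ σ)

  colDet-alternating : ∀ {n} → Alternating {Free n} (colDet {n})
  colDet-alternating {zero}  = nullary λ _ → refl
  colDet-alternating {suc n} = wedge-alternating (coordinate fzero)
    (alternating-pullback (reindex fsuc) colDet-alternating)

  basis-suc : ∀ {n} (i : Fin n) → Module._≈ᴹ_ (Free (suc n)) (basis (fsuc i)) (0# ∷ basis i)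
  basis-suc i fzero    = refl
  basis-suc i (fsuc j) = refl

  -- Expansion in the first coordinate and the Cauchy-Binet formula.

  module _ {b : ℕ} where
    private
      V = Free (suc b)
      module V = Module V

    lower : V.Carrierᴹ → V.Carrierᴹ
    lower v = 0# ∷ tail v

    lower-cong : ∀ {v w} → v V.≈ᴹ w → lower v V.≈ᴹ lower w
    lower-cong {v} {w} p = Hom.⟦⟧-cong 0∷ {tail v} {tail w} (p ∘ fsuc)

    split-head : ∀ v → v V.≈ᴹ ((v fzero V.*ₗ basis fzero) V.+ᴹ lower v)
    split-head v fzero    = sym (trans (+-identityʳ _) (*-identityʳ _))
    split-head v (fsuc i) = sym (trans (+-congʳ (zeroʳ _)) (+-identityˡ _))

    -- Contraction with the first basis vector e₀, made to depend only on the other coordinates by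
    -- `lower`.
    headPart : ∀ {m} → Form V (suc m) → Form V m
    headPart f B = f (basis fzero ∷ (lower ∘ B))

    headPart-respects : ∀ {m} {f : Form V (suc m)} → Respects {V} f → Respects {V} (headPart f)
    headPart-respects r {B} {C} p = r (∷-cong {V} {u = basis fzero} {v = basis fzero} (λ _ → refl)
      λ i → lower-cong {B i} {C i} (p i))

    lower-∷ : ∀ {m} v (B : Vector V.Carrierᴹ m) →
              _≋_ {V} (lower ∘ (v ∷ B)) (lower v ∷ (lower ∘ B))
    lower-∷ v B fzero    _ = refl
    lower-∷ v B (fsuc i) _ = refl

    -- Split each argument v as v₀ e₀ + `lower` v. Terms with e₀ twice vanish, and those with e₀
    -- once assemble to the wedge of the first coordinate with the contraction by e₀.
    expand-head : ∀ {m} {f : Form V (suc m)} → Alternating {V} f → ∀ A →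
                  f A ≈ f (lower ∘ A) + wedge {V} head (headPart f) A
    expand-head-∷ : ∀ m {f : Form V (suc m)} → Alternating {V} f → ∀ v A →
                    f (v ∷ A) ≈ f (lower ∘ (v ∷ A)) + wedge {V} head (headPart f) (v ∷ A)

    expand-head {m} {f} F A = begin
      f A                  ≈⟨ r (∷-head-tail {V} A) ⟩
      f (head A ∷ tail A)  ≈⟨ expand-head-∷ m F (head A) (tail A) ⟩
      f (lower ∘ (head A ∷ tail A)) + wedge {V} head (headPart f) (head A ∷ tail A)
        ≈⟨ +-cong (r λ i → lower-cong {(head A ∷ tail A) i} {A i} (A≋ i))
             (wedge-respects {V} (λ p → p fzero) (headPart-respects r) A≋) ⟩
      f (lower ∘ A) + wedge {V} head (headPart f) A ∎
      where
      r : Respects {V} f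
      r = alternating-respects F
      A≋ : _≋_ {V} (head A ∷ tail A) A
      A≋ i = V.≈ᴹ-sym {A i} {(head A ∷ tail A) i} (∷-head-tail {V} A i)

    expand-head-∷ m {f} F@(step r add scale fix alt) v A = begin
      f (v ∷ A)
        ≈⟨ r (∷-cong {V} {u = v} {v = (v fzero V.*ₗ basis fzero) V.+ᴹ lower v}
               (split-head v) (≋-refl {V} {A = A})) ⟩
      f ((v fzero V.*ₗ basis fzero) V.+ᴹ lower v ∷ A)
        ≈⟨ trans (add _ (lower v) A) (+-congʳ (scale (v fzero) (basis fzero) A)) ⟩
      v fzero * f (basis fzero ∷ A) + f (lower v ∷ A)
        ≈⟨ rest m F v A ⟩
      f (lower v ∷ (lower ∘ A)) + wedge {V} head (headPart f) (v ∷ A)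
        ≈⟨ +-congʳ (r (lower-∷ v A)) ⟨
      f (lower ∘ (v ∷ A)) + wedge {V} head (headPart f) (v ∷ A) ∎
      where
      rest : ∀ m {f : Form V (suc m)} → Alternating {V} f → ∀ v A →
             v fzero * f (basis fzero ∷ A) + f (lower v ∷ A) ≈
             f (lower v ∷ (lower ∘ A)) + wedge {V} head (headPart f) (v ∷ A)
      rest zero {f} (step r _ _ _ _) v A = begin
        v fzero * f (basis fzero ∷ A) + f (lower v ∷ A)
          ≈⟨ +-comm _ _ ⟩
        f (lower v ∷ A) + v fzero * f (basis fzero ∷ A)
          ≈⟨ +-cong (r (∷-cong {V} {u = lower v} {v = lower v} (λ _ → refl) λ ()))
               (*-congˡ (r (∷-cong {V} {u = basis fzero} {v = basis fzero} (λ _ → refl) λ ()))) ⟩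
        f (lower v ∷ (lower ∘ A)) + v fzero * headPart f A
          ≈⟨ +-congˡ (wedge-nullary {V} head (headPart-respects r) v A) ⟨
        f (lower v ∷ (lower ∘ A)) + wedge {V} head (headPart f) (v ∷ A) ∎
      rest (suc m) {f} F@(step r add scale fix alt) v A = begin
        v fzero * f (e ∷ A) + f (lower v ∷ A)
          ≈⟨ +-cong (*-congˡ (expand-head (fix e) A)) (expand-head (fix (lower v)) A) ⟩
        v fzero * (headPart f A + wedge {V} head (λ B → f (e ∷ e ∷ (lower ∘ B))) A) +
          (f (lower v ∷ (lower ∘ A)) + wedge {V} head (λ B → f (lower v ∷ e ∷ (lower ∘ B))) A)
          ≈⟨ +-congʳ (*-congˡ (trans (+-congˡ
               (trans (wedge-cong {V} head (λ B → alt e (lower ∘ B)) A) (wedge-0 {V} {m} head A)))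
               (+-identityʳ _))) ⟩
        v fzero * headPart f A +
          (f (lower v ∷ (lower ∘ A)) + wedge {V} head (λ B → f (lower v ∷ e ∷ (lower ∘ B))) A)
          ≈⟨ +-swap _ _ _ ⟩
        f (lower v ∷ (lower ∘ A)) +
          (v fzero * headPart f A + wedge {V} head (λ B → f (lower v ∷ e ∷ (lower ∘ B))) A)
          -- Moving e to the front costs exactly the sign that appears in `wedge-∷`.
          ≈⟨ +-congˡ (+-congˡ swap) ⟩
        f (lower v ∷ (lower ∘ A)) +
          (v fzero * headPart f A + - wedge {V} head (λ B → headPart f (v ∷ B)) A)
          ≈⟨ +-congˡ (wedge-∷ {V} head (headPart-respects r) v A) ⟨
        f (lower v ∷ (lower ∘ A)) + wedge {V} head (headPart f) (v ∷ A) ∎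
        where
        e = basis fzero
        swap : wedge {V} head (λ B → f (lower v ∷ e ∷ (lower ∘ B))) A ≈
               - wedge {V} head (λ B → headPart f (v ∷ B)) A
        swap = begin
          wedge {V} head (λ B → f (lower v ∷ e ∷ (lower ∘ B))) A
            ≈⟨ wedge-cong {V} head (λ B → alternating-swap F (lower v) e (lower ∘ B)) A ⟩
          wedge {V} head (λ B → - f (e ∷ lower v ∷ (lower ∘ B))) A
            ≈⟨ wedge-‿ {V} head (λ B → f (e ∷ lower v ∷ (lower ∘ B))) A ⟩
          - wedge {V} head (λ B → f (e ∷ lower v ∷ (lower ∘ B))) A
            ≈⟨ -‿cong (wedge-cong {V} head (λ B →
                 r (∷-cong {V} {u = e} {v = e} (λ _ → refl) (lower-∷ v B))) A) ⟨
          - wedge {V} head (λ B → headPart f (v ∷ B)) A ∎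

  -- That alternating forms are of this shape (minorSum below) is the
  -- Cauchy–Binet formula.
  data MinorSum (I : Ideal) {m b : ℕ} : Form (Free b) m → Set ℓ where
    term  : ∀ {c} → Mem I c → (σ : Fin m → Fin b) → MinorSum I (λ A → c * minorForm σ A)
    empty : MinorSum I (λ A → 0#)
    _⊕_   : ∀ {f g} → MinorSum I f → MinorSum I g → MinorSum I (λ A → f A + g A)
    resp  : ∀ {f g} → _≗_ {Free b} f g → MinorSum I f → MinorSum I g

  -- I records what is known of the coefficients of f, while the minors at A bring information of
  -- their own; products of two ideals enter in this way.
  minorSum-mem : ∀ {I N : Ideal} {m b} {f : Form (Free b) m} → MinorSum I f → ∀ {A} →
                 (∀ {c} → Mem I c → ∀ σ → Mem N (c * minorForm σ A)) → Mem N (f A)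
  minorSum-mem     (term c∈ σ) h = h c∈ σ
  minorSum-mem {N = N} empty      h = Submodule.0-closed N
  minorSum-mem {N = N} (p ⊕ q)    h =
    Submodule.+-closed N (minorSum-mem {N = N} p h) (minorSum-mem {N = N} q h)
  minorSum-mem {N = N} (resp e p) h = Submodule.resp N (e _) (minorSum-mem {N = N} p h)

  minorSum-tail : ∀ {I m b} {f : Form (Free b) m} → MinorSum I f →
                  MinorSum I {b = suc b} (λ A → f (tail ∘ A))
  minorSum-tail (term c∈ σ) = term c∈ (fsuc ∘ σ)
  minorSum-tail empty        = empty
  minorSum-tail (p ⊕ q)      = minorSum-tail p ⊕ minorSum-tail q
  minorSum-tail (resp e p)   = resp (λ A → e (tail ∘ A)) (minorSum-tail p)

  -- By Laplace expansion, the first coordinate wedged with the minor on rows σ is the minor on row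
  -- 0 and the shifted rows.
  minorSum-wedge : ∀ {I m b} {f : Form (Free b) m} → MinorSum I f →
                   MinorSum I (wedge {Free (suc b)} head (λ A → f (tail ∘ A)))
  minorSum-wedge {b = b} (term {c} c∈ σ) = resp
    (λ A → sym (wedge-* {Free (suc b)} head c (λ B → minorForm σ (tail ∘ B)) A))
    (term c∈ (fzero ∷ (fsuc ∘ σ)))
  minorSum-wedge {m = m} {b} empty =
    resp (λ A → sym (wedge-0 {Free (suc b)} {m} head A)) empty
  minorSum-wedge {b = b} (_⊕_ {f} {g} p q) = resp
    (λ A → sym (wedge-+ {Free (suc b)} head (λ B → f (tail ∘ B)) (λ B → g (tail ∘ B)) A))
    (minorSum-wedge p ⊕ minorSum-wedge q)
  minorSum-wedge {b = b} (resp {f} {g} e p) = resp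
    (wedge-cong {Free (suc b)} head {λ B → f (tail ∘ B)} {λ B → g (tail ∘ B)} (λ A → e (tail ∘ A)))
    (minorSum-wedge p)

  strictlyIncreasing-suc : ∀ {m b} {σ : Fin m → Fin b} → StrictlyIncreasing σ →
                           StrictlyIncreasing (fsuc ∘ σ)
  strictlyIncreasing-suc inc i j i<j = s≤s (inc i j i<j)

  strictlyIncreasing-∷ : ∀ {m b} {σ : Fin m → Fin b} → StrictlyIncreasing σ →
                         StrictlyIncreasing (fzero ∷ (fsuc ∘ σ))
  strictlyIncreasing-∷ inc fzero    (fsuc j) i<j       = s≤s z≤n
  strictlyIncreasing-∷ inc (fsuc i) (fsuc j) (s≤s i<j) = s≤s (inc i j i<j)

  -- The coefficients are the values of f on increasing families of basis vectors. Such a family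
  -- avoids e₀ or starts with it, which matches the two summands of `expand-head`.
  minorSum : ∀ (I : Ideal) {m b} {f : Form (Free b) m} → Alternating {Free b} f →
             (∀ σ → StrictlyIncreasing σ → Mem I (f (basis ∘ σ))) → MinorSum I f
  minorSum I {zero} {b} {f} F f∈ = resp
    (λ A → trans (*-identityʳ _) (alternating-respects F λ ()))
    (term (f∈ (λ ()) (λ ())) (λ ()))
  minorSum I {suc m} {zero} {f} F f∈ = resp
    (λ A → sym (trans (alternating-respects F (∷-head-tail {Free 0} A))
                      (alternating-zero F (tail A) λ ())))
    empty
  minorSum I {suc m} {suc b} {f} F@(step r _ _ fix _) f∈ =
    resp (λ A → sym (expand-head F A)) (minorSum-tail lowerSum ⊕ minorSum-wedge headSum)
    where
    lowerSum : MinorSum I {b = b} (λ A → f (λ j → 0# ∷ A j))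
    lowerSum = minorSum I (alternating-pullback 0∷ F) λ σ inc →
      Submodule.resp I (r (basis-suc ∘ σ)) (f∈ (fsuc ∘ σ) (strictlyIncreasing-suc inc))
    headSum : MinorSum I {b = b} (λ A → f (basis fzero ∷ λ j → 0# ∷ A j))
    headSum = minorSum I (alternating-pullback 0∷ (fix (basis fzero))) λ σ inc →
      Submodule.resp I
        (r λ { fzero _ → refl ; (fsuc j) → basis-suc (σ j) })
        (f∈ (fzero ∷ (fsuc ∘ σ)) (strictlyIncreasing-∷ inc))

  -- Forms in top degree, and the determinant in its rows.

  vanishing : ∀ {m n} {f : Form (Free n) (suc m)} → Alternating {Free n} f → n ≤ m →
              ∀ A → f A ≈ 0#
  vanishing {n = zero} F _ A = trans (alternating-respects F (∷-head-tail {Free 0} A))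
    (alternating-zero F (tail A) λ ())
  vanishing {suc m} {suc n} {f} F@(step r _ _ fix _) (s≤s n≤m) A = begin
    f A
      ≈⟨ expand-head F A ⟩
    f (lower ∘ A) + wedge {Free (suc n)} head (headPart f) A
      ≈⟨ +-cong (vanishing (alternating-pullback 0∷ F) (≤-trans n≤m (n≤1+n m)) (tail ∘ A))
           (trans (wedge-cong {Free (suc n)} head
             (λ B → vanishing (alternating-pullback 0∷ (fix (basis fzero))) n≤m (tail ∘ B)) A)
             (wedge-0 {Free (suc n)} {suc m} head A)) ⟩
    0# + 0#
      ≈⟨ +-identityˡ 0# ⟩
    0# ∎

  -- The first summand of `expand-head` has more arguments than the rank left to it and vanishes; by
  -- induction the second is a constant times the Laplace expansion of the determinant.
  uniqueness : ∀ {n} {f : Form (Free n) n} → Alternating {Free n} f →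
               ∀ A → f A ≈ colDet A * f basis
  uniqueness {zero}  F A = trans (alternating-respects F λ ()) (sym (*-identityˡ _))
  uniqueness {suc n} {f} F@(step r _ _ fix _) A = begin
    f A
      ≈⟨ expand-head F A ⟩
    f (lower ∘ A) + wedge {Free (suc n)} head (headPart f) A
      ≈⟨ +-congʳ (vanishing (alternating-pullback 0∷ F) ≤-refl (tail ∘ A)) ⟩
    0# + wedge {Free (suc n)} head (headPart f) A
      ≈⟨ +-identityˡ _ ⟩
    wedge {Free (suc n)} head (headPart f) A
      ≈⟨ wedge-cong {Free (suc n)} head (λ B → trans
           (uniqueness (alternating-pullback 0∷ (fix (basis fzero))) (tail ∘ B))
           (trans (*-comm _ _) (*-congʳ (sym (r basis≋))))) A ⟩
    wedge {Free (suc n)} head (λ B → f basis * colDet (tail ∘ B)) A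
      ≈⟨ wedge-* {Free (suc n)} head (f basis) (λ B → colDet (tail ∘ B)) A ⟩
    f basis * colDet A
      ≈⟨ *-comm _ _ ⟩
    colDet A * f basis ∎
    where
    basis≋ : _≋_ {Free (suc n)} basis (basis fzero ∷ λ j → 0# ∷ basis j)
    basis≋ fzero    _ = refl
    basis≋ (fsuc i)   = basis-suc i

  det-basis : ∀ {n} → det {n} basis ≈ 1#
  det-basis {zero}  = refl
  det-basis {suc n} = begin
    1# * (1# * det {n} basis) + sum (λ j → rest j)
      ≈⟨ +-cong (trans (*-identityˡ _) (trans (*-identityˡ _) (det-basis {n})))
           (sum-cong-≋ {n} {rest} {λ _ → 0#} λ j →
             trans (*-congˡ {(- 1#) ^ᴿ suc (toℕ j)} (zeroˡ _)) (zeroʳ _)) ⟩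
    1# + sum {n} (λ _ → 0#)
      ≈⟨ +-congˡ (sum-replicate-zero n) ⟩
    1# + 0#
      ≈⟨ +-identityʳ 1# ⟩
    1# ∎
    where
    rest : Fin n → Carrier
    rest j = ((- 1#) ^ᴿ suc (toℕ j)) *
             (0# * det (λ i k → basis (fsuc i) (punchIn (fsuc j) k)))

  -- Here the arguments are rows. The first row enters linearly, and fixing it leaves a combination
  -- of minors, alternating by induction. The crux is the equality of the two top rows, treated in
  -- `repeated`.
  det-alternating : ∀ {n} → Alternating {Free n} (det {n})
  det-alternating {zero}  = nullary λ _ → refl
  det-alternating {suc n} = step (λ p → det-cong λ i j → p i j)
    (λ u v A → begin
      sum (λ j → sgn j * ((u j + v j) * cofactor A j))
        ≈⟨ sum-cong-≋ (λ j → trans (*-congˡ {sgn j} (distribʳ (cofactor A j) (u j) (v j)))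
                                 (distribˡ _ _ _)) ⟩
      sum (λ j → sgn j * (u j * cofactor A j) + sgn j * (v j * cofactor A j))
        ≈⟨ ∑-distrib-+ (λ j → sgn j * (u j * cofactor A j)) (λ j → sgn j * (v j * cofactor A j)) ⟩
      det (u ∷ A) + det (v ∷ A) ∎)
    (λ s v A → begin
      sum (λ j → sgn j * ((s * v j) * cofactor A j))
        ≈⟨ sum-cong-≋ (λ j → trans (*-congˡ {sgn j} (*-assoc s (v j) (cofactor A j)))
             (*-swap (sgn j) s (v j * cofactor A j))) ⟩
      sum (λ j → s * (sgn j * (v j * cofactor A j)))
        ≈⟨ *-distribˡ-sum s (λ j → sgn j * (v j * cofactor A j)) ⟨
      s * det (v ∷ A) ∎)
    (λ v → alternating-sum λ j → alternating-* (sgn j) (alternating-* (v j)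
      (alternating-pullback (reindex (punchIn j)) det-alternating)))
    (repeated n)
    where
    sgn : ∀ {n} → Fin n → Carrier
    sgn j = (- 1#) ^ᴿ toℕ j

    cofactor : Vector (Fin (suc n) → Carrier) n → Fin (suc n) → Carrier
    cofactor A j = det (λ i k → A i (punchIn j k))

    -- Laplace expansion along two leading rows equal to v is v ∧ (v ∧ ω).
    repeated : ∀ n v → VanishesOn {Free (suc n)} v (λ A → det {suc n} (v ∷ A))
    repeated zero    v   = tt
    repeated (suc n) v A = trans
      -- On every column the coordinates 0 and 1 agree, since both top rows are v; this makes the
      -- two functionals the same.
      (wedge-congˡ {V} {φ = λ u → u fzero} {λ u → u (fsuc fzero)} (wedge {V} (λ u → u (fsuc fzero)) ω)
        {columns} (λ j → refl))
      (wedge-self {V} (λ u → u (fsuc fzero)) (λ p → p (fsuc fzero)) {ω}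
        (λ p → det-cong λ i k → p k (fsuc (fsuc i))) columns)
      where
      V = Free (suc (suc n))
      columns : Vector (Module.Carrierᴹ V) (suc (suc n))
      columns j i = (v ∷ v ∷ A) i j
      ω : Form V n
      ω C = det λ i k → C k (fsuc (fsuc i))

  -- Top-degree uniqueness for the row form `det`, normalised on the identity matrix.
  det-transpose : ∀ {n} (A : Fin n → Fin n → Carrier) → det A ≈ colDet A
  det-transpose {n} A = trans (uniqueness det-alternating A) (trans (*-congˡ (det-basis {n})) (*-identityʳ _))

  -- Block matrices and row operations.

  functional-sum : ∀ {n} (ψ : Hom (Free n) ⟨module⟩) v →
                   ⟦ ψ ⟧ v ≈ sum (λ k → v k * ⟦ ψ ⟧ (basis k))
  functional-sum {zero}  ψ v = trans (Hom.⟦⟧-cong ψ λ ()) (Hom.0ᴹ-homo ψ)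
  functional-sum {suc n} ψ v = begin
    ⟦ ψ ⟧ v
      ≈⟨ Hom.⟦⟧-cong ψ (split-head v) ⟩
    ⟦ ψ ⟧ (λ i → v fzero * basis fzero i + lower v i)
      ≈⟨ Hom.+ᴹ-homo ψ _ (lower v) ⟩
    ⟦ ψ ⟧ (λ i → v fzero * basis fzero i) + ⟦ ψ ⟧ (lower v)
      ≈⟨ +-cong (Hom.*ₗ-homo ψ (v fzero) (basis fzero)) (functional-sum ψ∘0∷ (tail v)) ⟩
    v fzero * ⟦ ψ ⟧ (basis fzero) + sum (λ k → v (fsuc k) * ⟦ ψ ⟧ (0# ∷ basis k))
      ≈⟨ +-congˡ (sum-cong-≋ λ k → *-congˡ {v (fsuc k)} (sym (Hom.⟦⟧-cong ψ (basis-suc k)))) ⟩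
    v fzero * ⟦ ψ ⟧ (basis fzero) + sum (λ k → v (fsuc k) * ⟦ ψ ⟧ (basis (fsuc k))) ∎
    where
    ψ∘0∷ : Hom (Free n) ⟨module⟩
    ψ∘0∷ = linear {Free n} {⟨module⟩} (λ w → ⟦ ψ ⟧ (0# ∷ w))
      (λ {v} {w} p → Hom.⟦⟧-cong ψ (Hom.⟦⟧-cong 0∷ {v} {w} p))
      (λ v w → trans (Hom.⟦⟧-cong ψ (Hom.+ᴹ-homo 0∷ v w)) (Hom.+ᴹ-homo ψ _ _))
      (λ r w → trans (Hom.⟦⟧-cong ψ (Hom.*ₗ-homo 0∷ r w)) (Hom.*ₗ-homo ψ r _))

  combination-lookup : ∀ {n N} (g : Fin n → Fin N → Carrier) v c →
                       combination (Free N) g v c ≈ sum (λ k → v k * g k c)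
  combination-lookup {zero}  g v c = refl
  combination-lookup {suc n} g v c = +-congˡ (combination-lookup (g ∘ fsuc) (v ∘ fsuc) c)

  basis-spans : ∀ {n} v → Span (Free n) (range (Free n) basis) v
  basis-spans {n} v = resp∈
    (λ i → trans (combination-lookup basis v i) (sym (functional-sum (coordinate i) v)))
    (combination-closed (Free n) (span (Free n) _) (gen-range (Free n)) v)

  injˡ : ∀ {k l} → Hom (Free k) (Free (k +ℕ l))
  injˡ {k} {l} = linear {Free k} {Free (k +ℕ l)} (_++ (λ _ → 0#))
    (λ p i → case i p) (λ v w i → add i v w) (λ r v i → scale i r v)
    where
    case : ∀ i {v w : Fin k → Carrier} → (∀ j → v j ≈ w j) → (v ++ (λ _ → 0#)) i ≈ (w ++ (λ _ → 0#)) i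
    case i p with splitAt k i
    ... | inj₁ j = p j
    ... | inj₂ j = refl
    add : ∀ i (v w : Fin k → Carrier) → ((λ j → v j + w j) ++ (λ _ → 0#)) i ≈
          (v ++ (λ _ → 0#)) i + (w ++ (λ _ → 0#)) i
    add i v w with splitAt k i
    ... | inj₁ j = refl
    ... | inj₂ j = sym (+-identityˡ 0#)
    scale : ∀ i r (v : Fin k → Carrier) → ((λ j → r * v j) ++ (λ _ → 0#)) i ≈ r * (v ++ (λ _ → 0#)) i
    scale i r v with splitAt k i
    ... | inj₁ j = refl
    ... | inj₂ j = sym (zeroʳ r)

  injʳ : ∀ {k l} → Hom (Free l) (Free (k +ℕ l))
  injʳ {k} {l} = linear {Free l} {Free (k +ℕ l)} ((λ (_ : Fin k) → 0#) ++_)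
    (λ p i → case i p) (λ v w i → add i v w) (λ r v i → scale i r v)
    where
    case : ∀ i {v w : Fin l → Carrier} → (∀ j → v j ≈ w j) →
           ((λ (_ : Fin k) → 0#) ++ v) i ≈ ((λ (_ : Fin k) → 0#) ++ w) i
    case i p with splitAt k i
    ... | inj₁ j = refl
    ... | inj₂ j = p j
    add : ∀ i (v w : Fin l → Carrier) → ((λ (_ : Fin k) → 0#) ++ (λ j → v j + w j)) i ≈
          ((λ (_ : Fin k) → 0#) ++ v) i + ((λ (_ : Fin k) → 0#) ++ w) i
    add i v w with splitAt k i
    ... | inj₁ j = sym (+-identityˡ 0#)
    ... | inj₂ j = refl
    scale : ∀ i r (v : Fin l → Carrier) → ((λ (_ : Fin k) → 0#) ++ (λ j → r * v j)) i ≈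
            r * ((λ (_ : Fin k) → 0#) ++ v) i
    scale i r v with splitAt k i
    ... | inj₁ j = sym (zeroʳ r)
    ... | inj₂ j = refl

  ++-injˡ+injʳ : ∀ {k l} (v : Fin k → Carrier) (x : Fin l → Carrier) i →
                 (v ++ x) i ≈ ⟦ injˡ {k} {l} ⟧ v i + ⟦ injʳ {k} {l} ⟧ x i
  ++-injˡ+injʳ {k} v x i with splitAt k i
  ... | inj₁ j = sym (+-identityʳ _)
  ... | inj₂ j = sym (+-identityˡ _)

  basis-++ : ∀ k l (i c : Fin (k +ℕ l)) →
             ((λ j → ⟦ injˡ {k} {l} ⟧ (basis j)) ++ (λ j → ⟦ injʳ {k} {l} ⟧ (basis j))) i c ≈ basis i c
  basis-++ zero    l i        c     = refl
  basis-++ (suc k) l fzero    fzero = refl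
  basis-++ (suc k) l fzero (fsuc c) with splitAt k c
  ... | inj₁ _ = refl
  ... | inj₂ _ = refl
  basis-++ (suc k) l (fsuc i) fzero with splitAt k i
  ... | inj₁ _ = refl
  ... | inj₂ _ = refl
  basis-++ (suc k) l (fsuc i) (fsuc c) with splitAt k i | basis-++ k l i c
  ... | inj₁ _ | e with splitAt k c | e
  ...   | inj₁ _ | e′ = e′
  ...   | inj₂ _ | e′ = e′
  basis-++ (suc k) l (fsuc i) (fsuc c) | inj₂ _ | e with splitAt k c | e
  ...   | inj₁ _ | e′ = e′
  ...   | inj₂ _ | e′ = e′

  -- Uniqueness in the last block turns W into the basis, whose span absorbs X by `shear`;
  -- uniqueness in the first block then turns V into the basis. Allowing any alternating form makes
  -- this usable for rows and for columns.
  blockTriangular : ∀ {k l} {f : Form (Free (k +ℕ l)) (k +ℕ l)} → Alternating {Free (k +ℕ l)} f →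
                    ∀ (V : Vector (Fin k → Carrier) k) (X : Vector (Fin l → Carrier) k)
                      (W : Vector (Fin l → Carrier) l) →
                    f ((λ j → V j ++ X j) ++ (λ j → ⟦ injʳ {k} {l} ⟧ (W j))) ≈
                    colDet V * (colDet W * f basis)
  blockTriangular {k} {l} {f} F V X W = begin
    f ((λ j → V j ++ X j) ++ (⟦ right ⟧ ∘ W))
      ≈⟨ uniqueness (alternating-pullback right (alternating-final {m = k} F (λ j → V j ++ X j))) W ⟩
    colDet W * f ((λ j → V j ++ X j) ++ (⟦ right ⟧ ∘ basis))
      ≈⟨ *-congˡ (shear {m = k} F (λ j → ++-injˡ+injʳ (V j) (X j))
           (λ j → range-least (Free l) (preimage right (span F′ (range F′ (⟦ right ⟧ ∘ basis))))
              (gen-range F′) (basis-spans (X j)))) ⟩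
    colDet W * f ((⟦ left ⟧ ∘ V) ++ (⟦ right ⟧ ∘ basis))
      ≈⟨ *-congˡ (uniqueness (alternating-pullback left (alternating-initial {m = k} F (⟦ right ⟧ ∘ basis))) V) ⟩
    colDet W * (colDet V * f ((⟦ left ⟧ ∘ basis) ++ (⟦ right ⟧ ∘ basis)))
      ≈⟨ *-congˡ (*-congˡ (alternating-respects F (basis-++ k l))) ⟩
    colDet W * (colDet V * f basis)
      ≈⟨ *-swap _ _ _ ⟩
    colDet V * (colDet W * f basis) ∎
    where
    F′    = Free (k +ℕ l)
    left  = injˡ {k} {l}
    right = injʳ {k} {l}

  rows : ∀ {n p} → Vector (Fin p → Carrier) n → Vector (Fin n → Carrier) p
  rows X i c = X c i

  rows-++ : ∀ {n p q} (X : Vector (Fin p → Carrier) n) (Y : Vector (Fin q → Carrier) n) r c →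
            (rows X ++ rows Y) r c ≈ (X c ++ Y c) r
  rows-++ {p = p} X Y r c with splitAt p r
  ... | inj₁ _ = refl
  ... | inj₂ _ = refl

  -- Applying T to the columns of Y forms combinations of the rows of Y, with the matrix entries of
  -- T as coefficients. These entries exist because T is defined on the whole free module.
  shear-rows : ∀ {n p q} {f : Form (Free n) (p +ℕ q)} → Alternating {Free n} f →
               (T : Hom (Free q) (Free p)) {X Z : Vector (Fin p → Carrier) n}
               {Y : Vector (Fin q → Carrier) n} →
               (∀ c i → Z c i ≈ X c i + ⟦ T ⟧ (Y c) i) →
               f (rows Z ++ rows Y) ≈ f (rows X ++ rows Y)
  shear-rows {n} {p} {q} F T {X} {Z} {Y} Z≈ = shear F (λ i c → Z≈ c i) λ i → resp∈
    (λ c → begin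
      combination (Free n) (rows Y) (λ k → ⟦ T ⟧ (basis k) i) c
        ≈⟨ combination-lookup (rows Y) (λ k → ⟦ T ⟧ (basis k) i) c ⟩
      sum (λ k → ⟦ T ⟧ (basis k) i * Y c k)
        ≈⟨ sum-cong-≋ (λ k → *-comm (⟦ T ⟧ (basis k) i) (Y c k)) ⟩
      sum (λ k → Y c k * ⟦ T ⟧ (basis k) i)
        ≈⟨ functional-sum (row i) (Y c) ⟨
      ⟦ T ⟧ (Y c) i ∎)
    (combination-closed (Free n) (span (Free n) _) (gen-range (Free n)) (λ k → ⟦ T ⟧ (basis k) i))
    where
    row : Fin p → Hom (Free q) ⟨module⟩
    row i = linear {Free q} {⟨module⟩} (λ v → ⟦ T ⟧ v i) (λ e → Hom.⟦⟧-cong T e i)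
      (λ v w → Hom.+ᴹ-homo T v w i) (λ r v → Hom.*ₗ-homo T r v i)

  unitIdeal : Ideal
  unitIdeal = record
    { Mem = λ _ → ⊤ ; resp = λ _ _ → _ ; 0-closed = _ ; +-closed = λ _ _ → _ ; *ₗ-closed = λ _ _ → _ }

  -- Cauchy-Binet with the unit ideal for the coefficients: the value is some combination of the
  -- maximal minors of X.
  minors⇒rows : ∀ (N : Ideal) {n p} {f : Form (Free n) p} → Alternating {Free n} f →
                ∀ X → (∀ σ → Mem N (colDet (X ∘ σ))) → Mem N (f (rows X))
  minors⇒rows N F X X∈ = minorSum-mem {N = N} (minorSum unitIdeal F λ _ _ → _) λ {c} _ σ →
    Submodule.*ₗ-closed N c (Submodule.resp N (sym (det-transpose (X ∘ σ))) (X∈ σ))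

  -- Laplace expansion along two blocks of rows, as Cauchy-Binet used twice: in the expansion by
  -- minors of Y the coefficients are themselves forms in the rows of X. The ideal I collects the
  -- coefficients that every minor of Y carries into N.
  minors⇒stack : ∀ (N : Ideal) {n p q} {f : Form (Free n) (p +ℕ q)} → Alternating {Free n} f →
                 ∀ X Y → (∀ σ τ → Mem N (colDet (X ∘ σ) * colDet (Y ∘ τ))) →
                 Mem N (f (rows X ++ rows Y))
  minors⇒stack N {q = q} F X Y XY∈ = minorSum-mem {N = N}
    (minorSum I (alternating-final F (rows X)) λ τ _ →
      minors⇒rows I (alternating-initial F (basis ∘ τ)) X λ σ τ → XY∈ σ τ)
    λ c∈ τ → Submodule.resp N (*-congˡ (sym (det-transpose (Y ∘ τ)))) (c∈ τ)
    where
    I : Ideal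
    I = record
      { Mem       = λ c → ∀ τ → Mem N (c * colDet {q} (Y ∘ τ))
      ; resp      = λ e c∈ τ → Submodule.resp N (*-congʳ e) (c∈ τ)
      ; 0-closed  = λ τ → Submodule.resp N (sym (zeroˡ _)) (Submodule.0-closed N)
      ; +-closed  = λ c∈ d∈ τ → Submodule.resp N (sym (distribʳ _ _ _)) (Submodule.+-closed N (c∈ τ) (d∈ τ))
      ; *ₗ-closed = λ r c∈ τ → Submodule.resp N (sym (*-assoc r _ _)) (Submodule.*ₗ-closed N r (c∈ τ))
      }

-- Submodules, lifts and projectivity of the relation module.

module ModuleLemmas {ℓ : Level} (R : CommutativeRing ℓ ℓ) where
  open CommutativeRing R hiding (zero)
  open Modules R
  open AlternatingForms R using (basis-spans)

  _∘ʰ_ : ∀ {A B C : Mod} → Hom B C → Hom A B → Hom A C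
  _∘ʰ_ {A} {B} {C} φ ψ = linear {A} {C} (λ x → ⟦ φ ⟧ (⟦ ψ ⟧ x))
    (λ e → Hom.⟦⟧-cong φ (Hom.⟦⟧-cong ψ e))
    (λ x y → C.≈ᴹ-trans (Hom.⟦⟧-cong φ (Hom.+ᴹ-homo ψ x y)) (Hom.+ᴹ-homo φ _ _))
    (λ r x → C.≈ᴹ-trans (Hom.⟦⟧-cong φ (Hom.*ₗ-homo ψ r x)) (Hom.*ₗ-homo φ r _))
    where module C = Module C

  _+ʰ_ : ∀ {A B : Mod} → Hom A B → Hom A B → Hom A B
  _+ʰ_ {A} {B} φ ψ = linear {A} {B} (λ x → ⟦ φ ⟧ x B.+ᴹ ⟦ ψ ⟧ x)
    (λ e → B.+ᴹ-cong (Hom.⟦⟧-cong φ e) (Hom.⟦⟧-cong ψ e))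
    (λ x y → B.≈ᴹ-trans (B.+ᴹ-cong (Hom.+ᴹ-homo φ x y) (Hom.+ᴹ-homo ψ x y))
                        (interchange B _ _ _ _))
    (λ r x → B.≈ᴹ-trans (B.+ᴹ-cong (Hom.*ₗ-homo φ r x) (Hom.*ₗ-homo ψ r x))
                        (B.≈ᴹ-sym (B.*ₗ-distribˡ r _ _)))
    where module B = Module B

  -ʰ_ : ∀ {A B : Mod} → Hom A B → Hom A B
  -ʰ_ {A} {B} φ = linear {A} {B} (λ x → B.-ᴹ (⟦ φ ⟧ x))
    (λ e → B.-ᴹ‿cong (Hom.⟦⟧-cong φ e))
    (λ x y → B.≈ᴹ-trans (B.-ᴹ‿cong (Hom.+ᴹ-homo φ x y))
                        (B.≈ᴹ-sym (AbelianGroupProperties.⁻¹-∙-comm B.+ᴹ-abelianGroup _ _)))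
    (λ r x → B.≈ᴹ-trans (B.-ᴹ‿cong (Hom.*ₗ-homo φ r x))
      (B.≈ᴹ-sym (B.uniqueʳ‿-ᴹ _ _ (B.≈ᴹ-trans (B.≈ᴹ-sym (B.*ₗ-distribˡ r _ _))
        (B.≈ᴹ-trans (B.*ₗ-congˡ (B.-ᴹ‿inverseʳ _)) (B.*ₗ-zeroʳ r))))))
    where module B = Module B

  homothety : ∀ {A : Mod} → Carrier → Hom A A
  homothety {A} s = linear {A} {A} (s A.*ₗ_) A.*ₗ-congˡ (A.*ₗ-distribˡ s)
    (λ r x → A.≈ᴹ-trans (A.≈ᴹ-sym (A.*ₗ-assoc s r x))
               (A.≈ᴹ-trans (A.*ₗ-congʳ (*-comm s r)) (A.*ₗ-assoc r s x)))
    where module A = Module A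

  idʰ : ∀ {A : Mod} → Hom A A
  idʰ {A} = linear {A} {A} (λ x → x) (λ e → e) (λ _ _ → A.≈ᴹ-refl) (λ _ _ → A.≈ᴹ-refl)
    where module A = Module A

  submodule : (M : Mod) → Submodule M → Mod
  submodule M N = record
    { Carrierᴹ = Σ M.Carrierᴹ (Mem N)
    ; _≈ᴹ_     = λ x y → proj₁ x M.≈ᴹ proj₁ y
    ; _+ᴹ_     = λ (x , p) (y , q) → x M.+ᴹ y , N.+-closed p q
    ; _*ₗ_     = λ r (x , p) → r M.*ₗ x , N.*ₗ-closed r p
    ; _*ᵣ_     = λ (x , p) r → r M.*ₗ x , N.*ₗ-closed r p
    ; 0ᴹ       = M.0ᴹ , N.0-closed
    ; -ᴹ_      = λ (x , p) → M.-ᴹ x , -‿closed M N p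
    ; isModule = IsModuleFromLeft.isModule record { isLeftModule = record
      { isLeftSemimodule = record
        { +ᴹ-isCommutativeMonoid = record
          { isMonoid = record
            { isSemigroup = record
              { isMagma = record
                { isEquivalence = record
                  { refl = M.≈ᴹ-refl ; sym = M.≈ᴹ-sym ; trans = M.≈ᴹ-trans }
                ; ∙-cong = M.+ᴹ-cong
                }
              ; assoc = λ (x , _) (y , _) (z , _) → M.+ᴹ-assoc x y z
              }
            ; identity = (λ (x , _) → M.+ᴹ-identityˡ x) , (λ (x , _) → M.+ᴹ-identityʳ x)
            }
          ; comm = λ (x , _) (y , _) → M.+ᴹ-comm x y
          }
        ; isPreleftSemimodule = record
          { *ₗ-cong      = M.*ₗ-cong
          ; *ₗ-zeroˡ     = λ (x , _) → M.*ₗ-zeroˡ x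
          ; *ₗ-distribʳ  = λ (x , _) r s → M.*ₗ-distribʳ x r s
          ; *ₗ-identityˡ = λ (x , _) → M.*ₗ-identityˡ x
          ; *ₗ-assoc     = λ r s (x , _) → M.*ₗ-assoc r s x
          ; *ₗ-zeroʳ     = M.*ₗ-zeroʳ
          ; *ₗ-distribˡ  = λ r (x , _) (y , _) → M.*ₗ-distribˡ r x y
          }
        }
      ; -ᴹ‿cong    = M.-ᴹ‿cong
      ; -ᴹ‿inverse = (λ (x , _) → M.-ᴹ‿inverseˡ x) , (λ (x , _) → M.-ᴹ‿inverseʳ x)
      } }
    }
    where
    module M = Module M
    module N = Submodule N

  inclusion : ∀ {M : Mod} (N : Submodule M) → Hom (submodule M N) M
  inclusion {M} N = linear {submodule M N} {M} proj₁ (λ e → e) (λ _ _ → M.≈ᴹ-refl) (λ _ _ → M.≈ᴹ-refl)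
    where module M = Module M

  corestrict : ∀ {A M : Mod} (N : Submodule M) (φ : Hom A M) → (∀ x → Mem N (⟦ φ ⟧ x)) →
               Hom A (submodule M N)
  corestrict {A} {M} N φ φ∈ = linear {A} {submodule M N} (λ x → ⟦ φ ⟧ x , φ∈ x)
    (Hom.⟦⟧-cong φ) (Hom.+ᴹ-homo φ) (Hom.*ₗ-homo φ)

  -- Preimages under an injective map are unique, so choosing them is automatically linear.
  factor : ∀ {A B C : Mod} (∂ : Hom A B) → Inj ∂ → (φ : Hom C B) →
           (∀ c → ∃[ a ] Module._≈ᴹ_ B (⟦ ∂ ⟧ a) (⟦ φ ⟧ c)) →
           Σ (Hom C A) λ ψ → ∀ c → Module._≈ᴹ_ B (⟦ ∂ ⟧ (⟦ ψ ⟧ c)) (⟦ φ ⟧ c)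
  factor {A} {B} {C} ∂ inj φ pre = linear {C} {A} (proj₁ ∘ pre)
    (λ {x} {y} e → inj (B.≈ᴹ-trans (eq x) (B.≈ᴹ-trans (Hom.⟦⟧-cong φ e) (B.≈ᴹ-sym (eq y)))))
    (λ x y → inj (B.≈ᴹ-trans (eq _) (B.≈ᴹ-trans (Hom.+ᴹ-homo φ x y)
      (B.≈ᴹ-trans (B.+ᴹ-cong (B.≈ᴹ-sym (eq x)) (B.≈ᴹ-sym (eq y))) (B.≈ᴹ-sym (Hom.+ᴹ-homo ∂ _ _))))))
    (λ r x → inj (B.≈ᴹ-trans (eq _) (B.≈ᴹ-trans (Hom.*ₗ-homo φ r x)
      (B.≈ᴹ-trans (B.*ₗ-congˡ (B.≈ᴹ-sym (eq x))) (B.≈ᴹ-sym (Hom.*ₗ-homo ∂ r _))))))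
    , eq
    where
    module B = Module B
    eq : ∀ c → ⟦ ∂ ⟧ (proj₁ (pre c)) B.≈ᴹ ⟦ φ ⟧ c
    eq c = proj₂ (pre c)

  equalizer : ∀ {A B : Mod} → Hom A B → Hom A B → Submodule A
  equalizer {A} {B} φ ψ = record
    { Mem       = λ x → ⟦ φ ⟧ x B.≈ᴹ ⟦ ψ ⟧ x
    ; resp      = λ e p → B.≈ᴹ-trans (Hom.⟦⟧-cong φ (A.≈ᴹ-sym e)) (B.≈ᴹ-trans p (Hom.⟦⟧-cong ψ e))
    ; 0-closed  = B.≈ᴹ-trans (Hom.0ᴹ-homo φ) (B.≈ᴹ-sym (Hom.0ᴹ-homo ψ))
    ; +-closed  = λ p q → B.≈ᴹ-trans (Hom.+ᴹ-homo φ _ _)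
                    (B.≈ᴹ-trans (B.+ᴹ-cong p q) (B.≈ᴹ-sym (Hom.+ᴹ-homo ψ _ _)))
    ; *ₗ-closed = λ r p → B.≈ᴹ-trans (Hom.*ₗ-homo φ r _)
                    (B.≈ᴹ-trans (B.*ₗ-congˡ p) (B.≈ᴹ-sym (Hom.*ₗ-homo ψ r _)))
    }
    where
    module A = Module A
    module B = Module B

  free-projective : ∀ n → IsProjective (Free n)
  free-projective n {A} {B} g surj f = h , λ v →
    range-least (Free n) (equalizer (g ∘ʰ h) f)
      (λ i → proj₂ (surj (⟦ f ⟧ (basis i))) (combination-basis A lifts i)) (basis-spans v)
    where
    lifts : Fin n → Module.Carrierᴹ A
    lifts i = proj₁ (surj (⟦ f ⟧ (basis i)))
    h : Hom (Free n) A
    h = fromFree A lifts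

  -- Schanuel: with 0 → P₁ → P₀ → P → 0 and lifts η : Rⁿ → P₀, θ : P₀ → Rⁿ of
  -- the identity of P, every v ∈ ker π is (v - θηv) + θηv with ηv ∈ P₁, which
  -- exhibits ker π as a retract of Rⁿ ⊕ P₁.
  kernel-projective : ∀ {P : Mod} → ProjectiveDimension≤1 P →
                      ∀ {n} (π : Hom (Free n) P) → Surj π →
                      IsProjective (submodule (Free n) (kernel π))
  kernel-projective {P} pd {n} π π-surj {A} {B} g g-surj f =
    ((ψ₁ ∘ʰ inclusion (kernel π)) +ʰ (ψ₂ ∘ʰ κ)) , λ x@(v , _) → begin
      ⟦ g ⟧ (⟦ ψ₁ ⟧ v A.+ᴹ ⟦ ψ₂ ⟧ (⟦ κ ⟧ x))
        ≈⟨ Hom.+ᴹ-homo g _ _ ⟩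
      ⟦ g ⟧ (⟦ ψ₁ ⟧ v) B.+ᴹ ⟦ g ⟧ (⟦ ψ₂ ⟧ (⟦ κ ⟧ x))
        ≈⟨ B.+ᴹ-cong (proj₂ lift₁ v) (proj₂ lift₂ (⟦ κ ⟧ x)) ⟩
      ⟦ f ⟧ (⟦ ρ₁ ⟧ v) B.+ᴹ ⟦ f ⟧ (⟦ ρ₂ ⟧ (⟦ κ ⟧ x))
        ≈⟨ Hom.+ᴹ-homo f _ _ ⟨
      ⟦ f ⟧ (⟦ ρ₁ ⟧ v K.+ᴹ ⟦ ρ₂ ⟧ (⟦ κ ⟧ x))
        ≈⟨ Hom.⟦⟧-cong f (λ i → retract v (⟦ κ ⟧ x) (proj₂ factored x) i) ⟩
      ⟦ f ⟧ x ∎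
    where
    open ProjectiveDimension≤1 pd
    open IsShortExact isShortExact
    F = Free n
    module A = Module A
    module B = Module B
    module P = Module P
    module P₀ = Module P₀
    module F = Module F
    module K = Module (submodule F (kernel π))
    open SetoidReasoning B.≈ᴹ-setoid

    θ-lift = P₀-projective π π-surj ε
    θ : Hom P₀ F
    θ = proj₁ θ-lift

    η-lift = free-projective n ε surjective π
    η : Hom F P₀
    η = proj₁ η-lift

    πθη : ∀ v → ⟦ π ⟧ (⟦ θ ⟧ (⟦ η ⟧ v)) P.≈ᴹ ⟦ π ⟧ v
    πθη v = P.≈ᴹ-trans (proj₂ θ-lift (⟦ η ⟧ v)) (proj₂ η-lift v)

    ρ₁ : Hom F (submodule F (kernel π))
    ρ₁ = corestrict (kernel π) (idʰ {F} +ʰ (-ʰ (θ ∘ʰ η))) λ v →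
      P.≈ᴹ-trans (Hom.+ᴹ-homo π v _)
        (P.≈ᴹ-trans (P.+ᴹ-congˡ (P.≈ᴹ-trans (Hom.-ᴹ-homo π _) (P.-ᴹ‿cong (πθη v))))
          (P.-ᴹ‿inverseʳ _))

    ρ₂ : Hom P₁ (submodule F (kernel π))
    ρ₂ = corestrict (kernel π) (θ ∘ʰ ∂) λ p →
      P.≈ᴹ-trans (proj₂ θ-lift (⟦ ∂ ⟧ p))
        (Equivalence.from (exact (⟦ ∂ ⟧ p)) (p , P₀.≈ᴹ-refl))

    factored : Σ (Hom (submodule F (kernel π)) P₁) λ κ →
               ∀ x → ⟦ ∂ ⟧ (⟦ κ ⟧ x) P₀.≈ᴹ ⟦ η ⟧ (proj₁ x)
    factored = factor ∂ injective (η ∘ʰ inclusion (kernel π)) λ (v , πv≈0) →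
      Equivalence.to (exact (⟦ η ⟧ v)) (P.≈ᴹ-trans (proj₂ η-lift v) πv≈0)
    κ : Hom (submodule F (kernel π)) P₁
    κ = proj₁ factored

    -- The sum of Rⁿ and P₁ is never formed: f composed with the retraction is lifted on each
    -- summand separately.
    lift₁ = free-projective n g g-surj (f ∘ʰ ρ₁)
    lift₂ = P₁-projective g g-surj (f ∘ʰ ρ₂)
    ψ₁ : Hom F A
    ψ₁ = proj₁ lift₁
    ψ₂ : Hom P₁ A
    ψ₂ = proj₁ lift₂

    retract : ∀ v p → ⟦ ∂ ⟧ p P₀.≈ᴹ ⟦ η ⟧ v →
              ((v F.+ᴹ F.-ᴹ (⟦ θ ⟧ (⟦ η ⟧ v))) F.+ᴹ ⟦ θ ⟧ (⟦ ∂ ⟧ p)) F.≈ᴹ v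
    retract v p e i = trans (+-congˡ (Hom.⟦⟧-cong θ e i))
      (trans (+-assoc _ _ _) (trans (+-congˡ (-‿inverseˡ _)) (+-identityʳ _)))

  uniform-annihilator : ∀ {S : Pred Carrier ℓ} → Localization.IsMultiplicative R S → ∀ {M : Mod} →
                        IsFinitelyGenerated M → Fitting.IsTorsion R S M →
                        ∃[ s ] S s × (∀ x → Module._≈ᴹ_ M (Module._*ₗ_ M s x) (Module.0ᴹ M))
  uniform-annihilator {S} mult {M} (n , g , g-gen) torsion with killAll n g
    where
    open Module M
    open Localization.IsMultiplicative mult
    killAll : ∀ n (g : Fin n → Carrierᴹ) → ∃[ s ] S s × (∀ i → s *ₗ g i ≈ᴹ 0ᴹ)
    killAll zero    g = 1# , 1∈S , λ ()
    killAll (suc n) g with torsion (g fzero) | killAll n (g ∘ fsuc)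
    ... | s , s∈S , sg≈0 | t , t∈S , tg≈0 = s * t , *∈S s∈S t∈S , λ
      { fzero    → ≈ᴹ-trans (*ₗ-congʳ (*-comm s t)) (≈ᴹ-trans (*ₗ-assoc t s _)
                     (≈ᴹ-trans (*ₗ-congˡ sg≈0) (*ₗ-zeroʳ t)))
      ; (fsuc i) → ≈ᴹ-trans (*ₗ-assoc s t _) (≈ᴹ-trans (*ₗ-congˡ (tg≈0 i)) (*ₗ-zeroʳ s)) }
  ... | s , s∈S , sg≈0 = s , s∈S , λ x → range-least M (kernel (homothety {M} s)) sg≈0 (g-gen x)

-- Fitting ideals and independence of the generators.

module FittingIdeals {ℓ : Level} (R : CommutativeRing ℓ ℓ) where
  open CommutativeRing R hiding (zero)
  open Modules R
  open CommutativeSemigroupProperties *-commutativeSemigroup using ()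
    renaming (x∙yz≈y∙xz to *-swap)
  open Exp semiring using () renaming (_^_ to _^ᴿ_)
  open AlternatingForms R
  open ModuleLemmas R
  open SetoidReasoning setoid

  Kills : ∀ {n} {M : Mod} → Hom (Free n) M → ∀ {k} → Vector (Fin n → Carrier) k → Set ℓ
  Kills {M = M} π V = ∀ j → Module._≈ᴹ_ M (⟦ π ⟧ (V j)) (Module.0ᴹ M)

  module _ {M : Mod} (Q : Presentation M) where
    open Presentation Q

    -- By exactness the columns lift through h. The pullback of `colDet` along h is alternating and
    -- its values on basis vectors are the minors of h, so Cauchy-Binet applies at the lifted
    -- columns.
    colDet∈fitting : ∀ {V : Vector (Fin a → Carrier) a} → Kills π V →
                     Mem (fittingIdeal Q) (colDet V)
    colDet∈fitting {V} kills = Submodule.resp I (det-cong λ i j → proj₂ (lift j) i)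
      (minorSum-mem {N = I}
        (minorSum I (alternating-pullback h colDet-alternating) λ σ inc → gen (σ , inc , refl))
        {proj₁ ∘ lift}
        λ {c} c∈ σ → Submodule.resp I (*-comm _ c) (Submodule.*ₗ-closed I _ c∈))
      where
      I = fittingIdeal Q
      lift : ∀ j → ∃[ u ] (∀ i → ⟦ h ⟧ u i ≈ V j i)
      lift j = Equivalence.to (exact (V j)) (kills j)

    -- The columns of h are relations, so each generating minor is itself some `colDet V`.
    fitting-least : (N : Ideal) →
                    (∀ (V : Vector (Fin a → Carrier) a) → Kills π V → Mem N (colDet V)) →
                    ∀ {x} → Mem (fittingIdeal Q) x → Mem N x
    fitting-least N V∈ = span-least ⟨module⟩ N λ (σ , _ , x≈) → Submodule.resp N (sym x≈)
      (V∈ (λ j → ⟦ h ⟧ (basis (σ j))) λ j →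
        Equivalence.from (exact _) (basis (σ j) , λ _ → refl))

  colDet-basis : ∀ {n} → colDet {n} basis ≈ 1#
  colDet-basis {n} = trans (sym (det-transpose (basis {n}))) (det-basis {n})

  module _ {M : Mod} where
    private module M = Module M

    -- With lifts T, U between the two free covers, V is traded for the matrix
    -- [ 1 - TU  TV ]
    -- [   - U    V ]
    -- of the same determinant, whose first q rows have columns in ker π₂.
    change-of-generators : ∀ {p q} (π₁ : Hom (Free p) M) → Surj π₁ →
                           (π₂ : Hom (Free q) M) → Surj π₂ → (N : Ideal) →
                           (∀ (W : Vector (Fin q → Carrier) q) → Kills π₂ W → Mem N (colDet W)) →
                           ∀ {V : Vector (Fin p → Carrier) p} → Kills π₁ V → Mem N (colDet V)
    change-of-generators {p} {q} π₁ surj₁ π₂ surj₂ N W∈ {V} killsV =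
      Submodule.resp N det≈
        -- The determinant alternates in its first q rows, so it is a combination of q × q minors of
        -- Z, whose columns π₂ kills.
        (minors⇒rows N (alternating-initial {m = q} det-alternating (rows Y)) Z
          λ σ → W∈ (Z ∘ σ) (killsZ ∘ σ))
      where
      T-lift = free-projective p π₂ surj₂ π₁
      T : Hom (Free p) (Free q)
      T = proj₁ T-lift
      U-lift = free-projective q π₁ surj₁ π₂
      U : Hom (Free q) (Free p)
      U = proj₁ U-lift

      X Z : Vector (Fin q → Carrier) (q +ℕ p)
      Y   : Vector (Fin p → Carrier) (q +ℕ p)
      X = basis ++ (λ _ _ → 0#)
      Y = (λ k → ⟦ -ʰ U ⟧ (basis k)) ++ V
      Z c i = X c i + ⟦ T ⟧ (Y c) i

      killsZ : Kills π₂ Z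
      killsZ c = M.≈ᴹ-trans (Hom.+ᴹ-homo π₂ (X c) (⟦ T ⟧ (Y c)))
        (M.≈ᴹ-trans (M.+ᴹ-congˡ (proj₂ T-lift (Y c))) (cancel c))
        where
        cancel : ∀ c → (⟦ π₂ ⟧ (X c) M.+ᴹ ⟦ π₁ ⟧ (Y c)) M.≈ᴹ M.0ᴹ
        cancel c with splitAt q c
        ... | inj₁ k = M.≈ᴹ-trans
          (M.+ᴹ-congˡ (M.≈ᴹ-trans (Hom.-ᴹ-homo π₁ _) (M.-ᴹ‿cong (proj₂ U-lift (basis k)))))
          (M.-ᴹ‿inverseʳ _)
        ... | inj₂ j = M.≈ᴹ-trans (M.+ᴹ-cong (Hom.0ᴹ-homo π₂) (killsV j)) (M.+ᴹ-identityˡ _)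

      columns : ∀ c i → (X c ++ Y c) i ≈
        ((λ k → basis k ++ ⟦ -ʰ U ⟧ (basis k)) ++ (λ j → ⟦ injʳ {q} {p} ⟧ (V j))) c i
      columns c i with splitAt q c
      ... | inj₁ k = refl
      ... | inj₂ j = refl

      det≈ : det (rows Z ++ rows Y) ≈ colDet V
      det≈ = begin
        det (rows Z ++ rows Y)
          ≈⟨ shear-rows {p = q} det-alternating T (λ _ _ → refl) ⟩
        det (rows X ++ rows Y)
          ≈⟨ det-cong (λ r c → trans (rows-++ X Y r c) (columns c r)) ⟩
        colDet ((λ k → basis k ++ ⟦ -ʰ U ⟧ (basis k)) ++ (λ j → ⟦ injʳ {q} {p} ⟧ (V j)))
          ≈⟨ blockTriangular {q} {p} colDet-alternating basis (λ k → ⟦ -ʰ U ⟧ (basis k)) V ⟩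
        colDet {q} basis * (colDet V * colDet {q +ℕ p} basis)
          ≈⟨ *-cong (colDet-basis {q}) (*-congˡ (colDet-basis {q +ℕ p})) ⟩
        1# * (colDet V * 1#)
          ≈⟨ trans (*-identityˡ _) (*-identityʳ _) ⟩
        colDet V ∎

  ++-take-drop : ∀ m {n} (xs : Vector Carrier (m +ℕ n)) i →
                 ((xs ∘ (_↑ˡ n)) ++ (xs ∘ (m ↑ʳ_))) i ≡ xs i
  ++-take-drop m {n} xs i = ≡.trans (lemma (splitAt m i)) (≡.cong xs (Finₚ.join-splitAt m n i))
    where
    lemma : ∀ s → [ xs ∘ (_↑ˡ n) , xs ∘ (m ↑ʳ_) ]′ s ≡ xs (join m n s)
    lemma (inj₁ _) = ≡.refl
    lemma (inj₂ _) = ≡.refl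

  ++-all : ∀ {A : Set ℓ} (P : A → Set ℓ) {m n} {xs : Vector A m} {ys : Vector A n} →
           (∀ i → P (xs i)) → (∀ j → P (ys j)) → ∀ k → P ((xs ++ ys) k)
  ++-all P {m} p q k with splitAt m k
  ... | inj₁ i = p i
  ... | inj₂ j = q j

  -- In [ V X ; 0 W ] the zero block belongs to the first columns but to the last rows, and
  -- `blockTriangular` wants it in the last vectors; hence the passage to rows.
  blockTriangular-transpose : ∀ {m n} (V : Vector (Fin m → Carrier) m)
    (X : Vector (Fin m → Carrier) n) (W : Vector (Fin n → Carrier) n) → ∀ r c →
    ((λ j → V j ++ (λ _ → 0#)) ++ (λ j → X j ++ W j)) c r ≈
    ((λ i → rows V i ++ rows X i) ++ (λ i → ⟦ injʳ {m} {n} ⟧ (rows W i))) r c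
  blockTriangular-transpose {m} V X W r c with splitAt m c in c≡
  blockTriangular-transpose {m} V X W r c | inj₁ j with splitAt m r
  ... | inj₁ _ rewrite c≡ = refl
  ... | inj₂ _ rewrite c≡ = refl
  blockTriangular-transpose {m} V X W r c | inj₂ j with splitAt m r
  ... | inj₁ _ rewrite c≡ = refl
  ... | inj₂ _ rewrite c≡ = refl

  -- Composed with this map, a map out of the relation module becomes a map of free modules, hence a
  -- matrix; this stands in for inverting s.
  multiples : ∀ {n} {M : Mod} (π : Hom (Free n) M) s →
              (∀ x → Module._≈ᴹ_ M (Module._*ₗ_ M s x) (Module.0ᴹ M)) →
              Hom (Free n) (submodule (Free n) (kernel π))
  multiples {n} {M} π s s-kills = corestrict (kernel π) (homothety {Free n} s) λ v →
    M.≈ᴹ-trans (Hom.*ₗ-homo π s v) (s-kills (⟦ π ⟧ v))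
    where module M = Module M

  *-cancel-^ : ∀ {s} → Localization.IsNonZeroDivisor R s → ∀ n {x y} → s ^ᴿ n * x ≈ s ^ᴿ n * y → x ≈ y
  *-cancel-^ nzd zero    e = trans (sym (*-identityˡ _)) (trans e (*-identityˡ _))
  *-cancel-^ {s} nzd (suc n) {x} {y} e = *-cancel-^ nzd n (x∙y⁻¹≈ε⇒x≈y _ _ (nzd _ (begin
    s * (s ^ᴿ n * x + - (s ^ᴿ n * y))
      ≈⟨ x[y-z]≈xy-xz s _ _ ⟩
    s * (s ^ᴿ n * x) + - (s * (s ^ᴿ n * y))
      ≈⟨ +-cong (*-assoc s _ x) (-‿cong (*-assoc s _ y)) ⟨
    s ^ᴿ suc n * x + - (s ^ᴿ suc n * y)
      ≈⟨ x≈y⇒x∙y⁻¹≈ε e ⟩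
    0# ∎)))
    where
    open AbelianGroupProperties +-abelianGroup using (x∙y⁻¹≈ε⇒x≈y; x≈y⇒x∙y⁻¹≈ε)
    open RingProperties ring using (x[y-z]≈xy-xz)

  -- Short exact sequences.

  module Extension {M′ M P : Mod} (Q′ : Presentation M′) (Q : Presentation M) (Qᴾ : Presentation P)
                   (f : Hom M′ M) (g : Hom M P) (fg : IsShortExact f g)
                   (K-projective : IsProjective
                     (submodule (Free (Presentation.a Qᴾ)) (kernel (Presentation.π Qᴾ))))
                   where
    private
      module Q′ = Presentation Q′
      module Q  = Presentation Q
      module Qᴾ = Presentation Qᴾ
      module M′ = Module M′
      module M  = Module M
      module P  = Module P
      m = Q′.a
      n = Qᴾ.a
      K = submodule (Free n) (kernel Qᴾ.π)
    open IsShortExact fg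

    μ-lift : Σ (Hom (Free n) M) λ μ → ∀ v → ⟦ g ⟧ (⟦ μ ⟧ v) P.≈ᴹ ⟦ Qᴾ.π ⟧ v
    μ-lift = free-projective n g surjective Qᴾ.π
    μ : Hom (Free n) M
    μ = proj₁ μ-lift

    top : Hom (Free (m +ℕ n)) (Free m)
    top = reindex (_↑ˡ n)

    bottom : Hom (Free (m +ℕ n)) (Free n)
    bottom = reindex (m ↑ʳ_)

    fπ′ : Hom (Free m) M
    fπ′ = f ∘ʰ Q′.π

    -- As in the horseshoe lemma, M is generated by the generators of M′ and lifts of those of P.
    π : Hom (Free (m +ℕ n)) M
    π = (fπ′ ∘ʰ top) +ʰ (μ ∘ʰ bottom)

    gf≈0 : ∀ x → ⟦ g ⟧ (⟦ f ⟧ x) P.≈ᴹ P.0ᴹ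
    gf≈0 x = Equivalence.from (exact _) (x , M.≈ᴹ-refl)

    π-++ : ∀ (t : Fin m → Carrier) (b : Fin n → Carrier) →
           ⟦ π ⟧ (t ++ b) M.≈ᴹ (⟦ fπ′ ⟧ t M.+ᴹ ⟦ μ ⟧ b)
    π-++ t b = M.+ᴹ-cong (Hom.⟦⟧-cong fπ′ λ i → reflexive (lookup-++ˡ t b i))
                         (Hom.⟦⟧-cong μ λ i → reflexive (lookup-++ʳ t b i))

    π-surjective : Surj π
    π-surjective x = t ++ b , λ e → M.≈ᴹ-trans (Hom.⟦⟧-cong π e) (M.≈ᴹ-trans (π-++ t b)
      (M.≈ᴹ-trans (M.+ᴹ-congʳ fπ′t≈) (M.≈ᴹ-trans (M.+ᴹ-assoc _ _ _)
        (M.≈ᴹ-trans (M.+ᴹ-congˡ (M.-ᴹ‿inverseˡ _)) (M.+ᴹ-identityʳ x)))))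
      where
      b : Fin n → Carrier
      b = proj₁ (Qᴾ.surjective (⟦ g ⟧ x))
      g[x-μb]≈0 : ⟦ g ⟧ (x M.+ᴹ M.-ᴹ ⟦ μ ⟧ b) P.≈ᴹ P.0ᴹ
      g[x-μb]≈0 = P.≈ᴹ-trans (Hom.+ᴹ-homo g x _) (P.≈ᴹ-trans
        (P.+ᴹ-congˡ (P.≈ᴹ-trans (Hom.-ᴹ-homo g _) (P.-ᴹ‿cong
          (P.≈ᴹ-trans (proj₂ μ-lift b) (proj₂ (Qᴾ.surjective (⟦ g ⟧ x)) (λ _ → refl))))))
        (P.-ᴹ‿inverseʳ _))
      y : M′.Carrierᴹ
      y = proj₁ (Equivalence.to (exact _) g[x-μb]≈0)
      t : Fin m → Carrier
      t = proj₁ (Q′.surjective y)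
      fπ′t≈ : ⟦ fπ′ ⟧ t M.≈ᴹ (x M.+ᴹ M.-ᴹ ⟦ μ ⟧ b)
      fπ′t≈ = M.≈ᴹ-trans (Hom.⟦⟧-cong f (proj₂ (Q′.surjective y) (λ _ → refl)))
        (proj₂ (Equivalence.to (exact _) g[x-μb]≈0))

    -μ : Hom K M
    -μ = -ʰ (μ ∘ʰ inclusion (kernel Qᴾ.π))

    -- On relations of P the map μ lands in ker g = im f, and f is injective. Up to sign the result
    -- represents the extension class in Ext¹(P, M′); the minus sign makes Λ b ++ b a relation.
    connecting : Σ (Hom K M′) λ δ → ∀ b → ⟦ f ⟧ (⟦ δ ⟧ b) M.≈ᴹ ⟦ -μ ⟧ b
    connecting = factor f injective -μ λ (b , πb≈0) → Equivalence.to (exact _)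
      (P.≈ᴹ-trans (Hom.-ᴹ-homo g _) (P.≈ᴹ-trans
        (P.-ᴹ‿cong (P.≈ᴹ-trans (proj₂ μ-lift b) πb≈0))
        (AbelianGroupProperties.ε⁻¹≈ε P.+ᴹ-abelianGroup)))

    -- b ↦ Λ b ++ b turns relations of P linearly into relations of M; its
    -- existence is where pd P ≤ 1 enters.
    Λ-lift : Σ (Hom K (Free m)) λ Λ → ∀ b → ⟦ Q′.π ⟧ (⟦ Λ ⟧ b) M′.≈ᴹ ⟦ proj₁ connecting ⟧ b
    Λ-lift = K-projective Q′.π Q′.surjective (proj₁ connecting)

    Λ : Hom K (Free m)
    Λ = proj₁ Λ-lift

    fπ′Λ : ∀ b → ⟦ fπ′ ⟧ (⟦ Λ ⟧ b) M.≈ᴹ (M.-ᴹ ⟦ μ ⟧ (proj₁ b))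
    fπ′Λ b = M.≈ᴹ-trans (Hom.⟦⟧-cong f (proj₂ Λ-lift b)) (proj₂ connecting b)

    -- Relations of M′ padded by zeros and relations of P extended by Λ form a block triangular
    -- matrix of relations for π, with the product as determinant.
    products∈ : ∀ (V′ : Vector (Fin m → Carrier) m) → Kills Q′.π V′ →
                ∀ (V : Vector (Fin n → Carrier) n) → Kills Qᴾ.π V →
                Mem (fittingIdeal Q) (colDet V′ * colDet V)
    products∈ V′ killsV′ V killsV = Submodule.resp (fittingIdeal Q) det≈
      (change-of-generators π π-surjective Q.π Q.surjective (fittingIdeal Q)
        (λ W → colDet∈fitting Q) killsW)
      where
      ΛV : Vector (Fin m → Carrier) n
      ΛV j = ⟦ Λ ⟧ (V j , killsV j)

      W : Vector (Fin (m +ℕ n) → Carrier) (m +ℕ n)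
      W = (λ j → V′ j ++ (λ _ → 0#)) ++ (λ j → ΛV j ++ V j)

      killsW : Kills π W
      killsW = ++-all (λ w → ⟦ π ⟧ w M.≈ᴹ M.0ᴹ)
        (λ j → M.≈ᴹ-trans (π-++ (V′ j) (λ _ → 0#)) (M.≈ᴹ-trans
          (M.+ᴹ-cong (M.≈ᴹ-trans (Hom.⟦⟧-cong f (killsV′ j)) (Hom.0ᴹ-homo f)) (Hom.0ᴹ-homo μ))
          (M.+ᴹ-identityˡ _)))
        (λ j → M.≈ᴹ-trans (π-++ (ΛV j) (V j)) (M.≈ᴹ-trans
          (M.+ᴹ-congʳ (fπ′Λ (V j , killsV j))) (M.-ᴹ‿inverseˡ _)))

      det≈ : colDet W ≈ colDet V′ * colDet V
      det≈ = begin
        colDet W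
          ≈⟨ det-cong (blockTriangular-transpose V′ ΛV V) ⟩
        det ((λ i → rows V′ i ++ rows ΛV i) ++ (λ i → ⟦ injʳ {m} {n} ⟧ (rows V i)))
          ≈⟨ blockTriangular {m} {n} det-alternating (rows V′) (rows ΛV) (rows V) ⟩
        det V′ * (det V * det {m +ℕ n} basis)
          ≈⟨ *-congˡ (trans (*-congˡ (det-basis {m +ℕ n})) (*-identityʳ _)) ⟩
        det V′ * det V
          ≈⟨ *-cong (det-transpose V′) (det-transpose V) ⟩
        colDet V′ * colDet V ∎

    -- Colon ideals extend `products∈` from pairs of generators to all elements, one factor at a
    -- time.
    fitting-⊇ : ∀ {c d} → Mem (fittingIdeal Q′) c → Mem (fittingIdeal Qᴾ) d →
                Mem (fittingIdeal Q) (d * c)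
    fitting-⊇ {c} {d} c∈ d∈ = fitting-least Q′ (colon d) (λ V′ killsV′ →
      Submodule.resp I (*-comm _ d)
        (fitting-least Qᴾ (colon (colDet V′)) (products∈ V′ killsV′) d∈)) c∈
      where
      I = fittingIdeal Q
      colon : Carrier → Ideal
      colon x = preimage (homothety {⟨module⟩} x) I

    -- With W = [ T ; B ] and B's columns in ker πᴾ, one has s T = s A + (s Λ) B
    -- for A = T - Λ B, whose columns lie in ker π′; the term (s Λ) B is removed
    -- by row operations, and then s cancels.
    fitting-⊆ : ∀ {s} → Localization.IsNonZeroDivisor R s → (∀ x → (s P.*ₗ x) P.≈ᴹ P.0ᴹ) →
                (N : Ideal) →
                (∀ {c d} → Mem (fittingIdeal Q′) c → Mem (fittingIdeal Qᴾ) d → Mem N (c * d)) →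
                ∀ {x} → Mem (fittingIdeal Q) x → Mem N x
    fitting-⊆ {s} nzd s-kills N cd∈ = fitting-least Q N λ V killsV →
      change-of-generators Q.π Q.surjective π π-surjective N
        (λ W killsW → Submodule.resp N (det≈ W killsW)
          -- Laplace expansion along the top m rows: minors of A come from relations of M′, those of
          -- B from relations of P.
          (minors⇒stack N {p = m} det-alternating (A W killsW) (⟦ bottom ⟧ ∘ W) λ σ τ →
            cd∈ (colDet∈fitting Q′ (killsA W killsW ∘ σ))
                (colDet∈fitting Qᴾ (killsB W killsW ∘ τ))))
        killsV
      where
      module _ (W : Vector (Fin (m +ℕ n) → Carrier) (m +ℕ n)) (killsW : Kills π W) where
        T : Vector (Fin m → Carrier) (m +ℕ n)
        T = ⟦ top ⟧ ∘ W
        B : Vector (Fin n → Carrier) (m +ℕ n)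
        B = ⟦ bottom ⟧ ∘ W

        killsB : Kills Qᴾ.π B
        killsB c = P.≈ᴹ-trans (P.≈ᴹ-sym (proj₂ μ-lift (B c))) (P.≈ᴹ-trans
          (P.≈ᴹ-sym (P.+ᴹ-identityˡ _)) (P.≈ᴹ-trans
          (P.+ᴹ-congʳ (P.≈ᴹ-sym (gf≈0 _))) (P.≈ᴹ-trans
          (P.≈ᴹ-sym (Hom.+ᴹ-homo g _ _)) (P.≈ᴹ-trans
          (Hom.⟦⟧-cong g (killsW c)) (Hom.0ᴹ-homo g)))))

        ΛB A : Vector (Fin m → Carrier) (m +ℕ n)
        ΛB c = ⟦ Λ ⟧ (B c , killsB c)
        A c i = T c i + - ΛB c i

        killsA : Kills Q′.π A
        -- As fπ′ Λ = - μ on relations, fπ′ (A c) equals π (W c), which is zero.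
        killsA c = injective (M.≈ᴹ-trans (Hom.+ᴹ-homo fπ′ (T c) _) (M.≈ᴹ-trans
          (M.+ᴹ-congˡ (M.≈ᴹ-trans (Hom.-ᴹ-homo fπ′ (ΛB c)) (M.≈ᴹ-trans
            (M.-ᴹ‿cong (fπ′Λ (B c , killsB c)))
            (AbelianGroupProperties.⁻¹-involutive M.+ᴹ-abelianGroup _))))
          (M.≈ᴹ-trans (killsW c) (M.≈ᴹ-sym (Hom.0ᴹ-homo f)))))

        sΛ : Hom (Free n) (Free m)
        sΛ = Λ ∘ʰ multiples Qᴾ.π s s-kills

        sT≈ : ∀ c i → s * T c i ≈ s * A c i + ⟦ sΛ ⟧ (B c) i
        sT≈ c i = begin
          s * T c i                          ≈⟨ *-congˡ T≈ ⟩
          s * (A c i + ΛB c i)               ≈⟨ distribˡ s _ _ ⟩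
          s * A c i + s * ΛB c i             ≈⟨ +-congˡ (Hom.*ₗ-homo Λ s (B c , killsB c) i) ⟨
          s * A c i + ⟦ Λ ⟧ (Module._*ₗ_ K s (B c , killsB c)) i
            ≈⟨ +-congˡ (Hom.⟦⟧-cong Λ (λ _ → refl) i) ⟩
          s * A c i + ⟦ sΛ ⟧ (B c) i         ∎
          where
          T≈ : T c i ≈ A c i + ΛB c i
          T≈ = sym (trans (+-assoc _ _ _) (trans (+-congˡ (-‿inverseˡ _)) (+-identityʳ _)))

        det≈ : det (rows A ++ rows B) ≈ colDet W
        -- The exponent is m because only the top m rows are scaled by s.
        det≈ = *-cancel-^ nzd m (begin
          s ^ᴿ m * det (rows A ++ rows B)
            ≈⟨ alternating-scale (alternating-initial {m = m} det-alternating (rows B)) s (rows A) ⟨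
          det ((λ i c → s * A c i) ++ rows B)
            ≈⟨ shear-rows {p = m} det-alternating sΛ sT≈ ⟨
          det ((λ i c → s * T c i) ++ rows B)
            ≈⟨ alternating-scale (alternating-initial {m = m} det-alternating (rows B)) s (rows T) ⟩
          s ^ᴿ m * det (rows T ++ rows B)
            ≈⟨ *-congˡ (det-cong λ r c → trans (rows-++ T B r c) (reflexive (++-take-drop m (W c) r))) ⟩
          s ^ᴿ m * colDet W ∎)

  -- The inverse of a Fitting ideal with projective relations.

  module Inverse {P : Mod} (Q : Presentation P)
                 (K-projective : IsProjective
                   (submodule (Free (Presentation.a Q)) (kernel (Presentation.π Q))))
                 {s : Carrier} (s-kills : ∀ x → Module._≈ᴹ_ P (Module._*ₗ_ P s x) (Module.0ᴹ P)) where
    open Presentation Q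
    private
      K = submodule (Free a) (kernel π)
      F = fittingIdeal Q

    -- (sᵃ : Fitt P), which is sᵃ times the inverse of Fitt P.
    scaledInverse : Ideal
    scaledInverse = record
      { Mem       = λ r → ∀ x → Mem F x → ∃[ y ] r * x ≈ s ^ᴿ a * y
      ; resp      = λ e p x x∈ → let (y , q) = p x x∈ in y , trans (*-congʳ (sym e)) q
      ; 0-closed  = λ x _ → 0# , trans (zeroˡ x) (sym (zeroʳ _))
      ; +-closed  = λ p q x x∈ → let (y , e) = p x x∈ ; (z , e′) = q x x∈ in
          y + z , trans (distribʳ x _ _) (trans (+-cong e e′) (sym (distribˡ _ y z)))
      ; *ₗ-closed = λ r p x x∈ → let (y , e) = p x x∈ in
          r * y , trans (*-assoc r _ x) (trans (*-congˡ e) (*-swap r _ y))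
      }

    hᴷ : Hom (Free b) K
    hᴷ = corestrict (kernel π) h λ u → Equivalence.from (exact _) (u , λ _ → refl)

    hᴷ-surjective : Surj hᴷ
    hᴷ-surjective (v , πv≈0) = let (u , hu≈v) = Equivalence.to (exact v) πv≈0 in
      u , λ e i → trans (Hom.⟦⟧-cong h e i) (hu≈v i)

    section : Σ (Hom K (Free b)) λ τ → ∀ v i → ⟦ h ⟧ (⟦ τ ⟧ v) i ≈ proj₁ v i
    section = K-projective hᴷ hᴷ-surjective (idʰ {K})

    τ : Hom K (Free b)
    τ = proj₁ section

    B : Hom (Free a) (Free b)
    B = τ ∘ʰ multiples π s s-kills

    -- The minor times `colDet V` is the determinant of the rows σ of B V. For relations V, B V = τ
    -- (s V) = s τ(V), and the a columns contribute sᵃ.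
    minors∈scaledInverse : ∀ (σ : Fin a → Fin b) →
                           Mem scaledInverse (minorForm σ (⟦ B ⟧ ∘ basis))
    minors∈scaledInverse σ x = fitting-least Q divisible λ V killsV →
      colDet (λ j → ⟦ τ ⟧ (V j , killsV j) ∘ σ) , (begin
        minorForm σ (⟦ B ⟧ ∘ basis) * colDet V
          ≈⟨ *-comm _ _ ⟩
        colDet V * minorForm σ (⟦ B ⟧ ∘ basis)
          ≈⟨ uniqueness (alternating-pullback (reindex σ ∘ʰ B) colDet-alternating) V ⟨
        minorForm σ (⟦ B ⟧ ∘ V)
          ≈⟨ det-cong (λ i j → trans (Hom.⟦⟧-cong τ (λ _ → refl) (σ i))
               (Hom.*ₗ-homo τ s (V j , killsV j) (σ i))) ⟩
        colDet (λ j i → s * ⟦ τ ⟧ (V j , killsV j) (σ i))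
          ≈⟨ alternating-scale colDet-alternating s (λ j → ⟦ τ ⟧ (V j , killsV j) ∘ σ) ⟩
        s ^ᴿ a * colDet (λ j → ⟦ τ ⟧ (V j , killsV j) ∘ σ) ∎)
      where
      r = minorForm σ (⟦ B ⟧ ∘ basis)
      divisible : Ideal
      divisible = record
        { Mem       = λ x → ∃[ y ] r * x ≈ s ^ᴿ a * y
        ; resp      = λ e (y , p) → y , trans (*-congˡ (sym e)) p
        ; 0-closed  = 0# , trans (zeroʳ r) (sym (zeroʳ _))
        ; +-closed  = λ (y , p) (z , q) → y + z ,
            trans (distribˡ r _ _) (trans (+-cong p q) (sym (distribˡ _ y z)))
        ; *ₗ-closed = λ t (y , p) → t * y ,
            trans (*-swap r t _) (trans (*-congˡ p) (*-swap t _ y))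
        }

    -- Cauchy–Binet for h B = s.
    power∈ : (N : Ideal) → (∀ {c d} → Mem F c → Mem scaledInverse d → Mem N (c * d)) →
             Mem N (s ^ᴿ a)
    power∈ N cd∈ = Submodule.resp N hB≈
      (minorSum-mem {N = N}
        (minorSum F (alternating-pullback h colDet-alternating) λ σ inc → gen (σ , inc , refl))
        {⟦ B ⟧ ∘ basis} λ c∈ σ → cd∈ c∈ (minors∈scaledInverse σ))
      where
      hB≈ : colDet (λ j → ⟦ h ⟧ (⟦ B ⟧ (basis j))) ≈ s ^ᴿ a
      hB≈ = begin
        colDet (λ j → ⟦ h ⟧ (⟦ B ⟧ (basis j)))
          ≈⟨ det-cong (λ i j → proj₂ section (⟦ multiples π s s-kills ⟧ (basis j)) i) ⟩
        colDet {a} (λ j i → s * basis j i)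
          ≈⟨ alternating-scale (colDet-alternating {a}) s basis ⟩
        s ^ᴿ a * colDet {a} basis
          ≈⟨ trans (*-congˡ (colDet-basis {a})) (*-identityʳ _) ⟩
        s ^ᴿ a ∎

-- Transfer to submodules of the ring of fractions.

module FittingInvariant {ℓ : Level} (R : CommutativeRing ℓ ℓ) (S : Pred (CommutativeRing.Carrier R) ℓ)
                        (noetherian : Modules.IsNoetherian R)
                        (mult : Localization.IsMultiplicative R S) where
  open CommutativeRing R hiding (zero)
  open Modules R
  open Exp semiring using () renaming (_^_ to _^ᴿ_)
  open RingSolver commutativeSemiring using (solve; con; _:=_; _:+_; _:*_)
  open Localization R using (frac; IsNonZeroDivisor)
  open Localization.IsMultiplicative mult
  open Fitting R S
  open ModuleLemmas R
  open FittingIdeals R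
  private
    module L = Localization R
    module Q = CommutativeRing (L.fractionRing S mult)
    S⁻¹R = L.S⁻¹R S mult
    ι = L.ι S mult
    Ω = L.Ω S mult
    𝓕 = Fitt noetherian mult

  presentation : (M : 𝓜) → Presentation (underlying M)
  presentation M = finitePresentation noetherian (𝓜.finitelyGenerated M)

  ^∈S : ∀ {s} → S s → ∀ n → S (s ^ᴿ n)
  ^∈S s∈S zero    = 1∈S
  ^∈S s∈S (suc n) = *∈S s∈S (^∈S s∈S n)

  over : ∀ {d} → S d → Hom ⟨module⟩ S⁻¹R
  over {d} d∈S = linear {⟨module⟩} {S⁻¹R} (λ r → frac r d d∈S)
    (λ e → L.cross S mult (*-congʳ e))
    (λ r s → L.cross S mult (solve 3 (λ r s d → (r :+ s) :* (d :* d) := (r :* d :+ s :* d) :* d) refl r s d))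
    (λ r s → Q.refl)

  -- At denominator 1 `over` is ι, so this also gives multiplicativity of ι.
  ι-* : ∀ c {d} (d∈S : S d) r → Module._≈ᴹ_ S⁻¹R (⟦ over d∈S ⟧ (c * r)) (⟦ ι ⟧ c Q.* ⟦ over d∈S ⟧ r)
  ι-* c {d} d∈S r = L.cross S mult (*-congˡ (*-identityˡ d))

  module _ (P : 𝓜) (pd : 𝓟 P) where
    private
      p = presentation P
      open Presentation p using (a; π; surjective)

    relations-projective : IsProjective (submodule (Free a) (kernel π))
    relations-projective = kernel-projective pd π surjective

    annihilator : ∃[ s ] S s × (∀ x → Module._≈ᴹ_ (underlying P) (Module._*ₗ_ (underlying P) s x)
                                                  (Module.0ᴹ (underlying P)))
    annihilator = uniform-annihilator mult {underlying P} (𝓜.finitelyGenerated P) (𝓜.torsion P)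

    private
      s    = proj₁ annihilator
      sᵃ∈S = ^∈S (proj₁ (proj₂ annihilator)) a
    open Inverse p relations-projective (proj₂ (proj₂ annihilator))

    𝓕⁻¹ : CommutativeMonoid.Carrier Ω
    𝓕⁻¹ = image (over sᵃ∈S) scaledInverse ,
          image-fg (over sᵃ∈S) {scaledInverse} (noetherian scaledInverse)

    𝓕-inverseʳ : CommutativeMonoid._≈_ Ω (CommutativeMonoid._∙_ Ω (𝓕 P) 𝓕⁻¹) (CommutativeMonoid.ε Ω)
    𝓕-inverseʳ = ⊆unit , unit⊆
      where
      I = proj₁ (𝓕 P)
      J = proj₁ 𝓕⁻¹
      U = L.unit S mult
      IJ = L._·_ S mult I J

      ⊆unit : ∀ {z} → Mem IJ z → Mem U z
      ⊆unit = L.·-least S mult I J U λ {x} {y} (c , c∈ , ιc≃x) (r , r∈ , r/d≃y) →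
        -- The definition of the colon ideal gives r c = sᵃ q, so c (r / sᵃ) is q times 1.
        let (q , rc≈dq) = r∈ c c∈ in
        resp∈ (Q.trans (L.cross S mult (begin
            q * 1# * (1# * s ^ᴿ a) ≈⟨ solve 2 (λ q d → q :* con 1 :* (con 1 :* d) := d :* q) refl q (s ^ᴿ a) ⟩
            s ^ᴿ a * q             ≈⟨ rc≈dq ⟨
            r * c                  ≈⟨ solve 2 (λ r c → r :* c := c :* r :* con 1) refl r c ⟩
            c * r * 1#             ∎))
          (Q.*-cong {⟦ ι ⟧ c} {x} {⟦ over sᵃ∈S ⟧ r} {y} ιc≃x r/d≃y))
          (*ₗ∈ q (gen Q.refl))
        where open SetoidReasoning setoid

      unit⊆ : ∀ {z} → Mem U z → Mem IJ z
      unit⊆ = span-least S⁻¹R IJ λ z≃1 → resp∈ (Q.sym z≃1)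
        -- Writing 1 as sᵃ / sᵃ reduces its membership to `power∈` for the numerator.
        (resp∈ (L.cross S mult (*-comm (s ^ᴿ a) 1#))
          (power∈ (preimage (over sᵃ∈S) IJ) λ {c} {d} c∈ d∈ →
            resp∈ (Q.sym (ι-* c sᵃ∈S d))
              (L.*-mem S mult I J (c , c∈ , Q.refl) (d , d∈ , Q.refl))))

    𝓕-invertible : Invertible (CommutativeMonoid._≈_ Ω) (CommutativeMonoid.ε Ω) (CommutativeMonoid._∙_ Ω) (𝓕 P)
    𝓕-invertible = 𝓕⁻¹ ,
      Ω.trans {𝓕⁻¹ Ω.∙ 𝓕 P} {𝓕 P Ω.∙ 𝓕⁻¹} {Ω.ε} (Ω.comm 𝓕⁻¹ (𝓕 P)) 𝓕-inverseʳ , 𝓕-inverseʳ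
      where module Ω = CommutativeMonoid Ω

    𝓕-multiplicative : (∀ s → S s → IsNonZeroDivisor s) → ∀ M′ M →
                       (f : Hom (underlying M′) (underlying M)) (g : Hom (underlying M) (underlying P)) →
                       IsShortExact f g →
                       CommutativeMonoid._≈_ Ω (𝓕 M) (CommutativeMonoid._∙_ Ω (𝓕 P) (𝓕 M′))
    𝓕-multiplicative nzd M′ M f g fg = ⊆product , product⊆
      where
      open Extension (presentation M′) (presentation M) p f g fg relations-projective
      I = proj₁ (𝓕 P)
      I′ = proj₁ (𝓕 M′)
      II′ = L._·_ S mult I I′

      ⊆product : ∀ {z} → Mem (proj₁ (𝓕 M)) z → Mem II′ z
      ⊆product (x , x∈ , ιx≃z) = resp∈ ιx≃z
        (fitting-⊆ (nzd s (proj₁ (proj₂ annihilator))) (proj₂ (proj₂ annihilator)) (preimage ι II′)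
          (λ {c} {d} c∈ d∈ → resp∈
            (Q.trans (Q.sym (ι-* d 1∈S c)) (Hom.⟦⟧-cong ι (*-comm d c)))
            (L.*-mem S mult I I′ (d , d∈ , Q.refl) (c , c∈ , Q.refl)))
          x∈)

      product⊆ : ∀ {z} → Mem II′ z → Mem (proj₁ (𝓕 M)) z
      product⊆ = L.·-least S mult I I′ (proj₁ (𝓕 M)) λ {x} {y} (d , d∈ , ιd≃x) (c , c∈ , ιc≃y) →
        d * c , fitting-⊇ c∈ d∈ , Q.trans (ι-* d 1∈S c) (Q.*-cong {⟦ ι ⟧ d} {x} {⟦ ι ⟧ c} {y} ιd≃x ιc≃y)

proposition2p7 : ∀ {ℓ : Level} (R : CommutativeRing ℓ ℓ) (S : Pred (CommutativeRing.Carrier R) ℓ) →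
    (noetherian : Modules.IsNoetherian R) →
    (mult : Localization.IsMultiplicative R S) →
    (∀ s → S s → Localization.IsNonZeroDivisor R s) →
    Fitting.IsFittingInvariant R S (Localization.Ω R S mult) (Fitting.Fitt R S noetherian mult)
proposition2p7 R S noetherian mult nzd = record
  { invertible     = 𝓕-invertible
  ; multiplicative = λ M′ M P pd → 𝓕-multiplicative P pd nzd M′ M
  }
  where open FittingInvariant R S noetherian mult
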